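{- For all integers $\ell, m \ge 8$, the coefficients $p_n(\ell,m)$ of the $q$-binomial coefficient satisfy the strict inequalities $$p_{1}(\ell,m) < p_2(\ell,m) < \cdots < p_{\lfloor \ell m/2\rfloor}(\ell,m) = p_{\lceil \ell m/2\rceil}(\ell,m) > \cdots > p_{\ell m-1}(\ell,m).$$
   Context: For nonnegative integers $\ell, m$, the $q$-binomial (Gaussian) coefficient is $$\binom{m+\ell}{m}_q = \frac{(q^{m+1}-1)\cdots(q^{m+\ell}-1)}{(q-1)\cdots(q^{\ell}-1)} = \sum_{n=0}^{\ell m} p_n(\ell,m)\, q^n,$$ so $p_n(\ell,m)$ is the number of partitions of $n$ whose Young diagram fits inside an $\ell\times m$ rectangle. -}

module Defs where

open import Data.Nat using (ℕ; zero; suc; _+_; _∸_; _≤ᵇ_)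
open import Data.Bool using (if_then_else_)

-- boxCount k n b : number of non-increasing sequences (a₁ ≥ … ≥ a_k) of
-- k natural numbers with every aᵢ ≤ b and a₁ + … + a_k = n,
-- i.e. partitions of n with at most k parts, each part ≤ b.
-- Recursion: choose the first (largest) entry a ∈ {0,…,b}; the remaining
-- k-1 entries are bounded by a and sum to n - a.
boxCount : ℕ → ℕ → ℕ → ℕ
boxCount zero    zero    b = 1
boxCount zero    (suc n) b = 0
boxCount (suc k) n       b = go b
  where
  go : ℕ → ℕ
  go zero    = boxCount k n 0
  go (suc a) = (if suc a ≤ᵇ n then boxCount k (n ∸ suc a) (suc a) else 0) + go a

-- p n ℓ m : the number of partitions of n whose Young diagram fits inside an
-- ℓ × m rectangle (at most ℓ parts, each ≤ m); the coefficient of q^n in the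
-- Gaussian binomial coefficient [m+ℓ choose m]_q.
p : ℕ → ℕ → ℕ → ℕ
p n ℓ m = boxCount ℓ n m

{-# OPTIONS --safe #-}
module Submission where

-- A polynomial f of degree ℓ in x_0, …, x_m all of whose monomials have weight n (x_i has weight i)
-- is a seminvariant if E f = 0 for the derivation E = Σ i x_{i-1} ∂_i.  There are p n ℓ m such monomials,
-- so p (n-1) ℓ m < p n ℓ m forces a nonzero seminvariant of weight n: more unknowns than equations.
-- Conversely let F = Σ (m-i) x_{i+1} ∂_i, so that [E, F] = m deg − 2 weight.  In weight n − 1 < ℓm/2
-- the operator E F is injective, hence a nonzero seminvariant of weight n ≤ ℓm/2 is independent of the
-- image of F and p (n-1) ℓ m < p n ℓ m.
-- Since E is a derivation and polynomials form a domain, nonzero seminvariants multiply: degrees and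
-- weights add.  Multiplying by seminvariants of degree 8, whose weights are 0, 2, 3, …, 4m, leads from
-- ℓ to ℓ + 8, and p n ℓ m = p n m ℓ does the same for m.  The cases 8 ≤ ℓ, m ≤ 15 are computed.

open import Defs
open import Data.Product
open import Relation.Binary.PropositionalEquality
open import Relation.Nullary

-- `E` and `F` generate the classical sl2 action on polynomials in the coefficients of a binary form
-- of degree m, but no representation theory is used. Since E lowers the weight, an equation E F f =
-- - c f with c ≥ 0 is passed on to E f with a larger c, down to weight 0. There E f = 0 for lack of
-- monomials, and a positive multiple of f vanishes; on the way back up, E f = 0 gives the same
-- conclusion in each weight.
--
-- The obstacle to the induction is weight 1. As p 0 ℓ m = p 1 ℓ m = 1, the counting argument yields
-- no seminvariant of weight 1, and sums of the available weights must still reach every weight from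
-- 2 to half the new area. The even step 8 loses nothing to rounding: ⌊(8 + ℓ)m/2⌋ = 4m + ⌊ℓm/2⌋,
-- whereas two rectangles of odd area would fall short by one. The theorem for 8 × m itself supplies
-- the factors.
--
-- All coefficients are integers, so elimination avoids division, and positivity enters only through
-- cancelling a nonzero integer.

module Partitions where

  open import Data.Bool using (Bool; true; false; T; _∧_; if_then_else_)
  open import Data.Bool.Properties using (T-∧)
  open import Data.List using (List; []; _∷_; length; drop; replicate)
  open import Data.Nat
  open import Data.Nat.Properties
  open import Data.Nat.Tactic.RingSolver using (solve-∀)
  open import Data.Sum using (inj₁; inj₂)
  open import Data.Unit using (⊤; tt)
  open import Function.Bundles using (Equivalence)

  -- The coefficients of q^k f(q), with `z` below degree `k`. Recursion on `k` and the index avoids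
  -- truncated subtraction; the open type `A` serves counts and lists of monomials alike.
  delay : {A : Set} → A → ℕ → (ℕ → A) → ℕ → A
  delay z zero    f n       = f n
  delay z (suc k) f zero    = z
  delay z (suc k) f (suc n) = delay z k f n

  delay-elim : {A : Set} (P : A → Set) {z : A} → P z → ∀ k f n →
    (∀ r → k + r ≡ n → P (f r)) → P (delay z k f n)
  delay-elim P Pz zero    f n       Pf = Pf n refl
  delay-elim P Pz (suc k) f zero    Pf = Pz
  delay-elim P Pz (suc k) f (suc n) Pf = delay-elim P Pz k f n λ r eq → Pf r (cong suc eq)

  delay-map : {A B : Set} (h : A → B) (z : A) → ∀ k f n → h (delay z k f n) ≡ delay (h z) k (λ i → h (f i)) n
  delay-map h z zero    f n       = refl
  delay-map h z (suc k) f zero    = refl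
  delay-map h z (suc k) f (suc n) = delay-map h z k f n

  delay-≥ : {A : Set} (z : A) → ∀ k f r → delay z k f (k + r) ≡ f r
  delay-≥ z zero    f r = refl
  delay-≥ z (suc k) f r = delay-≥ z k f r

  shift : ℕ → (ℕ → ℕ) → ℕ → ℕ
  shift = delay 0

  shift-if : ∀ k f n → shift k f n ≡ (if k ≤ᵇ n then f (n ∸ k) else 0)
  shift-if zero f n = refl
  shift-if (suc k) f zero = refl
  shift-if (suc zero) f (suc n) = refl
  shift-if (suc (suc k)) f (suc n) = shift-if (suc k) f n

  shift-cong : ∀ k {f g} → (∀ n → f n ≡ g n) → ∀ n → shift k f n ≡ shift k g n
  shift-cong zero    f≗g n       = f≗g n
  shift-cong (suc k) f≗g zero    = refl
  shift-cong (suc k) f≗g (suc n) = shift-cong k f≗g n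

  shift-+ : ∀ k f g n → shift k (λ i → f i + g i) n ≡ shift k f n + shift k g n
  shift-+ zero    f g n       = refl
  shift-+ (suc k) f g zero    = refl
  shift-+ (suc k) f g (suc n) = shift-+ k f g n

  shift-shift : ∀ j k f n → shift j (shift k f) n ≡ shift (j + k) f n
  shift-shift zero    k f n       = refl
  shift-shift (suc j) k f zero    = refl
  shift-shift (suc j) k f (suc n) = shift-shift j k f n

  shift-< : ∀ k f {n} → n < k → shift k f n ≡ 0
  shift-< (suc k) f {zero}  _         = refl
  shift-< (suc k) f {suc n} (s≤s n<k) = shift-< k f n<k

  -- Unification recovers the local function of boxCount, whose hidden bound c
  -- has to be separated from its last argument.
  mutual
    go : ℕ → ℕ → ℕ → ℕ → ℕ
    go = _

    go-unfold : ∀ k n b → boxCount (suc k) n (suc b) ≡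
      (if suc b ≤ᵇ n then boxCount k (n ∸ suc b) (suc b) else 0) + go k n (suc b) b
    go-unfold k n b with suc b
    ... | c = refl

  go-bound : ∀ k n c b → go k n c b ≡ boxCount (suc k) n b
  go-bound k n c zero    = refl
  go-bound k n c (suc b) =
    cong ((if suc b ≤ᵇ n then boxCount k (n ∸ suc b) (suc b) else 0) +_)
         (trans (go-bound k n c b) (sym (go-bound k n (suc b) b)))

  -- The q-Pascal recurrences and the symmetries of the rectangle

  p-remove-part : ∀ ℓ m n → p n (suc ℓ) (suc m) ≡
    shift (suc m) (λ i → p i ℓ (suc m)) n + p n (suc ℓ) m
  p-remove-part ℓ m n =
    cong₂ _+_ (sym (shift-if (suc m) (λ i → p i ℓ (suc m)) n)) (go-bound ℓ n (suc m) m)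

  p-0-const : ∀ m m′ n → p n 0 m ≡ p n 0 m′
  p-0-const m m′ zero    = refl
  p-0-const m m′ (suc n) = refl

  p-ℓ-0 : ∀ ℓ n → p n ℓ 0 ≡ p n 0 0
  p-ℓ-0 zero    n = refl
  p-ℓ-0 (suc ℓ) n = p-ℓ-0 ℓ n

  -- The second q-Pascal recurrence: either all `suc ℓ` entries are positive and the first column
  -- can be removed, or the last entry is 0. Since `p` peels off rows only, this needs an induction:
  -- expand by the largest part, apply the hypothesis to both terms, regroup. Removing a row and
  -- then a column, or the reverse, takes away the same hook of m + ℓ + 3 cells.
  p-remove-column : ∀ ℓ m n → p n (suc ℓ) (suc m) ≡
    shift (suc ℓ) (λ i → p i (suc ℓ) m) n + p n ℓ (suc m)
  p-remove-column zero zero n = begin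
    p n 1 1                                       ≡⟨ p-remove-part 0 0 n ⟩
    shift 1 (λ i → p i 0 1) n + p n 0 0           ≡⟨ cong₂ _+_ (shift-cong 1 (p-0-const 1 0) n) (p-0-const 0 1 n) ⟩
    shift 1 (λ i → p i 0 0) n + p n 0 1           ∎
    where open ≡-Reasoning
  p-remove-column zero (suc m) n = begin
    p n 1 (2 + m)                                                      ≡⟨ p-remove-part 0 (suc m) n ⟩
    shift (2 + m) (λ i → p i 0 (2 + m)) n + p n 1 (suc m)              ≡⟨ cong₂ _+_ (shift-cong (2 + m) (p-0-const (2 + m) (suc m)) n) (p-remove-column 0 m n) ⟩
    shift (2 + m) p₀ n + (shift 1 (λ i → p i 1 m) n + p n 0 (suc m))   ≡⟨ cong₂ (λ x y → x + (shift 1 (λ i → p i 1 m) n + y)) (sym (shift-shift 1 (suc m) p₀ n)) (p-0-const (suc m) (2 + m) n) ⟩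
    shift 1 (shift (suc m) p₀) n + (shift 1 (λ i → p i 1 m) n + p n 0 (2 + m))   ≡⟨ +-assoc (shift 1 (shift (suc m) p₀) n) _ _ ⟨
    shift 1 (shift (suc m) p₀) n + shift 1 (λ i → p i 1 m) n + p n 0 (2 + m)     ≡⟨ cong (_+ p n 0 (2 + m)) (shift-+ 1 (shift (suc m) p₀) (λ i → p i 1 m) n) ⟨
    shift 1 (λ i → shift (suc m) p₀ i + p i 1 m) n + p n 0 (2 + m)     ≡⟨ cong (_+ p n 0 (2 + m)) (shift-cong 1 (p-remove-part 0 m) n) ⟨
    shift 1 (λ i → p i 1 (suc m)) n + p n 0 (2 + m)                    ∎
    where
      open ≡-Reasoning
      p₀ : ℕ → ℕ
      p₀ i = p i 0 (suc m)
  p-remove-column (suc ℓ) zero n = begin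
    p n (2 + ℓ) 1                                                      ≡⟨ p-remove-part (suc ℓ) 0 n ⟩
    shift 1 (λ i → p i (suc ℓ) 1) n + p n (2 + ℓ) 0                    ≡⟨ cong (_+ p n (2 + ℓ) 0) (shift-cong 1 (p-remove-column ℓ 0) n) ⟩
    shift 1 (λ i → shift (suc ℓ) p₀ i + p i ℓ 1) n + p n (suc ℓ) 0     ≡⟨ cong (_+ p n (suc ℓ) 0) (shift-+ 1 (shift (suc ℓ) p₀) (λ i → p i ℓ 1) n) ⟩
    shift 1 (shift (suc ℓ) p₀) n + shift 1 (λ i → p i ℓ 1) n + p n (suc ℓ) 0     ≡⟨ +-assoc (shift 1 (shift (suc ℓ) p₀) n) _ _ ⟩
    shift 1 (shift (suc ℓ) p₀) n + (shift 1 (λ i → p i ℓ 1) n + p n (suc ℓ) 0)   ≡⟨ cong₂ _+_ (shift-shift 1 (suc ℓ) p₀ n) (sym (p-remove-part ℓ 0 n)) ⟩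
    shift (2 + ℓ) p₀ n + p n (suc ℓ) 1                                 ∎
    where
      open ≡-Reasoning
      p₀ : ℕ → ℕ
      p₀ i = p i (suc ℓ) 0
  p-remove-column (suc ℓ) (suc m) n = begin
    p n (2 + ℓ) (2 + m)                                                ≡⟨ p-remove-part (suc ℓ) (suc m) n ⟩
    shift (2 + m) (λ i → p i (suc ℓ) (2 + m)) n + p n (2 + ℓ) (suc m)
      ≡⟨ cong₂ _+_ (trans (shift-cong (2 + m) (p-remove-column ℓ (suc m)) n) (shift-+ (2 + m) (shift (suc ℓ) f) g n))
                   (p-remove-column (suc ℓ) m n) ⟩
    (shift (2 + m) (shift (suc ℓ) f) n + shift (2 + m) g n) + (shift (2 + ℓ) h n + f n)
      ≡⟨ cong (λ x → (x + shift (2 + m) g n) + (shift (2 + ℓ) h n + f n)) commute ⟩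
    (shift (2 + ℓ) (shift (suc m) f) n + shift (2 + m) g n) + (shift (2 + ℓ) h n + f n)
      ≡⟨ rearrange (shift (2 + ℓ) (shift (suc m) f) n) _ _ _ ⟩
    (shift (2 + ℓ) (shift (suc m) f) n + shift (2 + ℓ) h n) + (shift (2 + m) g n + f n)
      ≡⟨ cong₂ _+_ (trans (shift-cong (2 + ℓ) (p-remove-part (suc ℓ) m) n) (shift-+ (2 + ℓ) (shift (suc m) f) h n))
                   (p-remove-part ℓ (suc m) n) ⟨
    shift (2 + ℓ) (λ i → p i (2 + ℓ) (suc m)) n + p n (suc ℓ) (2 + m)  ∎
    where
      open ≡-Reasoning
      f g h : ℕ → ℕ
      f i = p i (suc ℓ) (suc m)
      g i = p i ℓ (2 + m)
      h i = p i (2 + ℓ) m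
      index : ∀ m ℓ → 2 + m + (1 + ℓ) ≡ 2 + ℓ + (1 + m)
      index = solve-∀
      commute : shift (2 + m) (shift (suc ℓ) f) n ≡ shift (2 + ℓ) (shift (suc m) f) n
      commute = begin
        shift (2 + m) (shift (suc ℓ) f) n  ≡⟨ shift-shift (2 + m) (suc ℓ) f n ⟩
        shift (2 + m + suc ℓ) f n          ≡⟨ cong (λ k → shift k f n) (index m ℓ) ⟩
        shift (2 + ℓ + suc m) f n          ≡⟨ shift-shift (2 + ℓ) (suc m) f n ⟨
        shift (2 + ℓ) (shift (suc m) f) n  ∎
      rearrange : ∀ a b c d → (a + b) + (c + d) ≡ (a + c) + (b + d)
      rearrange = solve-∀

  -- Interchanging `ℓ` and `m` turns the row recurrence into the column recurrence.
  p-transpose : ∀ ℓ m n → p n ℓ m ≡ p n m ℓ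
  p-transpose zero    m       n = trans (p-0-const m 0 n) (sym (p-ℓ-0 m n))
  p-transpose (suc ℓ) zero    n = trans (p-ℓ-0 ℓ n) (p-0-const 0 (suc ℓ) n)
  p-transpose (suc ℓ) (suc m) n = begin
    p n (suc ℓ) (suc m)                                          ≡⟨ p-remove-part ℓ m n ⟩
    shift (suc m) (λ i → p i ℓ (suc m)) n + p n (suc ℓ) m        ≡⟨ cong₂ _+_ (shift-cong (suc m) (p-transpose ℓ (suc m)) n) (p-transpose (suc ℓ) m n) ⟩
    shift (suc m) (λ i → p i (suc m) ℓ) n + p n m (suc ℓ)        ≡⟨ p-remove-column m ℓ n ⟨
    p n (suc m) (suc ℓ)                                          ∎
    where open ≡-Reasoning

  p-beyond : ∀ ℓ m {n} → ℓ * m < n → p n ℓ m ≡ 0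
  p-beyond zero    m       {suc n} _  = refl
  p-beyond (suc ℓ) zero    {n}     lt = p-beyond ℓ zero lt
  p-beyond (suc ℓ) (suc m) {n}     lt = begin
    p n (suc ℓ) (suc m)                                    ≡⟨ p-remove-part ℓ m n ⟩
    shift (suc m) (λ i → p i ℓ (suc m)) n + p n (suc ℓ) m  ≡⟨ cong (shift (suc m) _ n +_) (p-beyond (suc ℓ) m (≤-<-trans (*-monoʳ-≤ (suc ℓ) (n≤1+n m)) lt)) ⟩
    shift (suc m) (λ i → p i ℓ (suc m)) n + 0              ≡⟨ +-identityʳ _ ⟩
    shift (suc m) (λ i → p i ℓ (suc m)) n                  ≡⟨ cong (shift (suc m) _) (m+[n∸m]≡n sm≤n) ⟨
    shift (suc m) (λ i → p i ℓ (suc m)) (suc m + (n ∸ suc m))   ≡⟨ delay-≥ 0 (suc m) _ (n ∸ suc m) ⟩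
    p (n ∸ suc m) ℓ (suc m)                                ≡⟨ p-beyond ℓ (suc m) (+-cancelˡ-< (suc m) _ _ (subst (suc ℓ * suc m <_) (sym (m+[n∸m]≡n sm≤n)) lt)) ⟩
    0                                                      ∎
    where
      open ≡-Reasoning
      sm≤n : suc m ≤ n
      sm≤n = ≤-trans (m≤m+n (suc m) (ℓ * suc m)) (<⇒≤ lt)

  -- Reflection about N becomes reflection about k + N when only `f` is multiplied by q^k. For a < k
  -- the left side is 0; then b > N, where `g` vanishes.
  shift-complement : ∀ k N (f g : ℕ → ℕ) → (∀ {a} → N < a → g a ≡ 0) → (∀ a b → a + b ≡ N → f a ≡ g b) →
    ∀ a b → a + b ≡ k + N → shift k f a ≡ g b
  shift-complement k N f g beyond f~g a b eq with ≤-total k a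
  ... | inj₁ k≤a = begin
    shift k f a              ≡⟨ cong (shift k f) (m+[n∸m]≡n k≤a) ⟨
    shift k f (k + (a ∸ k))  ≡⟨ delay-≥ 0 k f (a ∸ k) ⟩
    f (a ∸ k)                ≡⟨ f~g (a ∸ k) b (+-cancelˡ-≡ k _ _ (trans (sym (+-assoc k (a ∸ k) b)) (trans (cong (_+ b) (m+[n∸m]≡n k≤a)) eq))) ⟩
    g b                      ∎
    where open ≡-Reasoning
  ... | inj₂ a≤k with m≤n⇒m<n∨m≡n a≤k
  ...   | inj₂ refl = trans (trans (cong (shift a f) (sym (+-identityʳ a))) (delay-≥ 0 a f 0)) (f~g 0 b (+-cancelˡ-≡ a _ _ eq))
  ...   | inj₁ a<k = trans (shift-< k f a<k) (sym (beyond (+-cancelˡ-< k _ _ (subst (_< k + b) eq (+-monoˡ-< b a<k)))))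

  -- Complementation turns a part of full size into a part 0. Hence the row recurrence at `a` is
  -- matched with the column recurrence at `b`, the two summands in opposite order.
  p-complement : ∀ ℓ m a b → a + b ≡ ℓ * m → p a ℓ m ≡ p b ℓ m
  p-complement zero    m zero zero _ = refl
  p-complement (suc ℓ) zero a b eq = p-complement ℓ zero a b eq
  p-complement (suc ℓ) (suc m) a b eq = begin
    p a (suc ℓ) (suc m)                                          ≡⟨ p-remove-part ℓ m a ⟩
    shift (suc m) (λ i → p i ℓ (suc m)) a + p a (suc ℓ) m
      ≡⟨ cong₂ _+_ (shift-complement (suc m) (ℓ * suc m) (λ i → p i ℓ (suc m)) (λ i → p i ℓ (suc m)) (p-beyond ℓ (suc m)) (p-complement ℓ (suc m)) a b eq)
                   (sym (shift-complement (suc ℓ) (suc ℓ * m) (λ i → p i (suc ℓ) m) (λ i → p i (suc ℓ) m) (p-beyond (suc ℓ) m) (p-complement (suc ℓ) m) b a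
                          (trans (+-comm b a) (trans eq (*-suc (suc ℓ) m))))) ⟩
    p b ℓ (suc m) + shift (suc ℓ) (λ i → p i (suc ℓ) m) b        ≡⟨ +-comm (p b ℓ (suc m)) _ ⟩
    shift (suc ℓ) (λ i → p i (suc ℓ) m) b + p b ℓ (suc m)        ≡⟨ p-remove-column ℓ m b ⟨
    p b (suc ℓ) (suc m)                                          ∎
    where open ≡-Reasoning

  StrictlyIncreasing : ℕ → ℕ → Set
  StrictlyIncreasing ℓ m = ∀ n → 1 ≤ n → n < ⌊ ℓ * m /2⌋ → p n ℓ m < p (suc n) ℓ m

  -- Tabulation of the small rectangles

  coeff : List ℕ → ℕ → ℕ
  coeff []       n       = 0
  coeff (x ∷ xs) zero    = x
  coeff (x ∷ xs) (suc n) = coeff xs n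

  addShifted : ℕ → List ℕ → List ℕ → List ℕ
  addShifted zero    []       ys       = ys
  addShifted zero    (x ∷ xs) []       = x ∷ xs
  addShifted zero    (x ∷ xs) (y ∷ ys) = x + y ∷ addShifted zero xs ys
  addShifted (suc k) xs       []       = 0 ∷ addShifted k xs []
  addShifted (suc k) xs       (y ∷ ys) = y ∷ addShifted k xs ys

  coeff-addShifted : ∀ k xs ys n → coeff (addShifted k xs ys) n ≡ shift k (coeff xs) n + coeff ys n
  coeff-addShifted zero    []       ys       n       = refl
  coeff-addShifted zero    (x ∷ xs) []       n       = sym (+-identityʳ _)
  coeff-addShifted zero    (x ∷ xs) (y ∷ ys) zero    = refl
  coeff-addShifted zero    (x ∷ xs) (y ∷ ys) (suc n) = coeff-addShifted zero xs ys n
  coeff-addShifted (suc k) xs       []       zero    = refl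
  coeff-addShifted (suc k) xs       []       (suc n) = coeff-addShifted k xs [] n
  coeff-addShifted (suc k) xs       (y ∷ ys) zero    = refl
  coeff-addShifted (suc k) xs       (y ∷ ys) (suc n) = coeff-addShifted k xs ys n

  Lists : ℕ → ℕ → List ℕ → Set
  Lists ℓ m xs = ∀ n → coeff xs n ≡ p n ℓ m

  Row : ℕ → ℕ → List (List ℕ) → Set
  Row ℓ m []         = ⊤
  Row ℓ m (xs ∷ xss) = Lists ℓ m xs × Row (suc ℓ) m xss

  -- Each new list comes from its predecessor in the new row and its counterpart in the old row, by
  -- `p-remove-part`. A rectangle thus costs one addition of lists, while unfolding `boxCount` would
  -- revisit the same rectangles over and over.
  nextRow : ℕ → List ℕ → List (List ℕ) → List (List ℕ)
  nextRow m xs []         = []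
  nextRow m xs (ys ∷ yss) = zs ∷ nextRow m zs yss
    where zs = addShifted (suc m) xs ys

  nextRow-Row : ∀ ℓ m xs yss → Lists ℓ (suc m) xs → Row (suc ℓ) m yss → Row (suc ℓ) (suc m) (nextRow m xs yss)
  nextRow-Row ℓ m xs []         _  _         = tt
  nextRow-Row ℓ m xs (ys ∷ yss) hx (hy , hs) = hz , nextRow-Row (suc ℓ) m _ yss hz hs
    where
    hz : Lists (suc ℓ) (suc m) (addShifted (suc m) xs ys)
    hz n = trans (coeff-addShifted (suc m) xs ys n)
      (trans (cong₂ _+_ (shift-cong (suc m) hx n) (hy n)) (sym (p-remove-part ℓ m n)))

  Lists-1 : ∀ m → Lists 0 m (1 ∷ [])
  Lists-1 m zero    = refl
  Lists-1 m (suc n) = refl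

  row : ℕ → ℕ → List (List ℕ)
  row k zero    = replicate k (1 ∷ [])
  row k (suc m) = nextRow m (1 ∷ []) (row k m)

  row-Row : ∀ k m → Row 1 m (row k m)
  row-Row k (suc m) = nextRow-Row 0 m _ (row k m) (Lists-1 (suc m)) (row-Row k m)
  row-Row k zero    = first k 1
    where
    first : ∀ k ℓ → Row ℓ 0 (replicate k (1 ∷ []))
    first zero    ℓ = tt
    first (suc k) ℓ = (λ n → trans (Lists-1 0 n) (sym (p-ℓ-0 ℓ n))) , first k (suc ℓ)

  increasing : ℕ → List ℕ → Bool
  increasing zero    _            = true
  increasing (suc k) (x ∷ y ∷ ys) = (x <ᵇ y) ∧ increasing k (y ∷ ys)
  increasing (suc k) _            = false

  increasing-sound : ∀ k xs → T (increasing k xs) → ∀ {n} → n < k → coeff xs n < coeff xs (suc n)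
  increasing-sound (suc k) (x ∷ y ∷ ys) t {n} n<k with Equivalence.to (T-∧ {x <ᵇ y}) t
  increasing-sound (suc k) (x ∷ y ∷ ys) t {zero}  _         | x<y , _  = <ᵇ⇒< x y x<y
  increasing-sound (suc k) (x ∷ y ∷ ys) t {suc n} (s≤s n<k) | _   , t′ = increasing-sound k (y ∷ ys) t′ n<k

  strictRow : ℕ → ℕ → List (List ℕ) → Bool
  strictRow ℓ m []         = true
  -- The constant coefficient is dropped because the chain starts at n = 1; ⌊ℓm/2⌋ - 1 comparisons
  -- remain.
  strictRow ℓ m (xs ∷ xss) = increasing (⌊ ℓ * m /2⌋ ∸ 1) (drop 1 xs) ∧ strictRow (suc ℓ) m xss

  strictRow-sound : ∀ ℓ m xss → Row ℓ m xss → T (strictRow ℓ m xss) →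
    ∀ {i} → i < length xss → StrictlyIncreasing (ℓ + i) m
  strictRow-sound ℓ m (xs ∷ xss) (h , hs) t {i} i<
    with Equivalence.to (T-∧ {increasing (⌊ ℓ * m /2⌋ ∸ 1) (drop 1 xs)}) t
  strictRow-sound ℓ m (xs ∷ xss) (h , hs) t {suc i} (s≤s i<) | _ , t′ =
    subst (λ k → StrictlyIncreasing k m) (sym (+-suc ℓ i)) (strictRow-sound (suc ℓ) m xss hs t′ i<)
  strictRow-sound ℓ m (xs ∷ xss) (h , hs) t {zero} _ | t′ , _ =
    subst (λ k → StrictlyIncreasing k m) (sym (+-identityʳ ℓ)) strict
    where
    coeff-drop : ∀ ys n → coeff (drop 1 ys) n ≡ coeff ys (suc n)
    coeff-drop []       n = refl
    coeff-drop (y ∷ ys) n = refl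
    strict : StrictlyIncreasing ℓ m
    strict (suc n) _ n< = subst₂ _<_
      (trans (coeff-drop xs n) (h (suc n))) (trans (coeff-drop xs (suc n)) (h (2 + n)))
      (increasing-sound _ (drop 1 xs) t′ (∸-monoˡ-≤ 1 n<))

  drop-Row : ∀ i ℓ m xss → Row ℓ m xss → Row (ℓ + i) m (drop i xss)
  drop-Row zero    ℓ m xss        h       = subst (λ k → Row k m xss) (sym (+-identityʳ ℓ)) h
  drop-Row (suc i) ℓ m []         h       = tt
  drop-Row (suc i) ℓ m (xs ∷ xss) (_ , h) = subst (λ k → Row k m (drop i xss)) (sym (+-suc ℓ i)) (drop-Row i (suc ℓ) m xss h)

  -- For a numeral `m` both hypotheses hold by evaluation, and one evaluation settles ℓ = 8, ..., 15
  -- together.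
  table-check : ∀ m → T (strictRow 8 m (drop 7 (row 15 m))) → length (drop 7 (row 15 m)) ≡ 8 →
    ∀ i → i < 8 → StrictlyIncreasing (8 + i) m
  table-check m t len i i<8 =
    strictRow-sound 8 m (drop 7 (row 15 m)) (drop-Row 7 1 m (row 15 m) (row-Row 15 m)) t (subst (i <_) (sym len) i<8)

  base-case : ∀ i j → i < 8 → j < 8 → StrictlyIncreasing (8 + i) (8 + j)
  base-case i 0 i<8 _ = table-check 8 tt refl i i<8
  base-case i 1 i<8 _ = table-check 9 tt refl i i<8
  base-case i 2 i<8 _ = table-check 10 tt refl i i<8
  base-case i 3 i<8 _ = table-check 11 tt refl i i<8
  base-case i 4 i<8 _ = table-check 12 tt refl i i<8
  base-case i 5 i<8 _ = table-check 13 tt refl i i<8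
  base-case i 6 i<8 _ = table-check 14 tt refl i i<8
  base-case i 7 i<8 _ = table-check 15 tt refl i i<8
  base-case i (suc (suc (suc (suc (suc (suc (suc (suc _)))))))) _ (s≤s (s≤s (s≤s (s≤s (s≤s (s≤s (s≤s (s≤s ()))))))))

module Seminvariants where

  open import Data.Empty using (⊥)
  open import Data.Integer using (ℤ; +_; 0ℤ; 1ℤ; -_; _+_; _*_; _≟_)
  open import Data.Integer.Properties hiding (_≟_)
  open import Data.Integer.Tactic.RingSolver using (solve-∀)
  open import Data.List as List using (List; []; _∷_; _++_; length)
  open import Data.List.Membership.Propositional using (_∈_; find)
  open import Data.List.Membership.Propositional.Properties using (∈-map⁺; ∈-map⁻; ∈-++⁺ˡ; ∈-++⁺ʳ)
  open import Data.List.Properties using (length-++; length-map)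
  open import Data.List.Relation.Unary.All as All using (All; []; _∷_)
  import Data.List.Relation.Unary.All.Properties as All
  open import Data.List.Relation.Unary.Any using (here; there)
  open import Data.List.Relation.Unary.Unique.Propositional using (Unique; []; _∷_)
  import Data.List.Relation.Unary.Unique.Propositional.Properties as Unique
  open import Data.Nat as ℕ using (ℕ; zero; suc; s≤s; z<s)
  open import Data.Nat.Induction using (<-rec)
  import Data.Nat.Properties as ℕ
  import Data.Nat.Tactic.RingSolver as ℕ
  open import Data.Sum using (_⊎_; inj₁; inj₂; [_,_]′)
  open import Data.Vec as Vec using (Vec; []; _∷_; sum; fromList)
  open import Data.Vec.Properties using (≡-dec; ∷-injectiveʳ)
  open import Data.Vec.Relation.Unary.Any as VAny using (here; there)
  open import Function using (_∘_; case_of_)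

  open Partitions

  -- Linear operators on series in finitely many variables

  record Linear {A B : Set} (T : (A → ℤ) → B → ℤ) : Set where
    field
      cong-≗ : ∀ {f g} → f ≗ g → T f ≗ T g
      +-homo : ∀ f g y → T (λ x → f x + g x) y ≡ T f y + T g y
      *-homo : ∀ c f y → T (λ x → c * f x) y ≡ c * T f y

    vanish : ∀ {f} → (∀ x → f x ≡ 0ℤ) → ∀ y → T f y ≡ 0ℤ
    vanish {f} f≡0 y = trans (cong-≗ {g = λ x → 0ℤ * f x} f≡0 y) (*-homo 0ℤ f y)

  open Linear

  -- The power series in x_{k-1}, …, x_0 with coefficients f; the head of an exponent vector belongs to x_{k-1}.
  Series : ℕ → Set
  Series k = Vec ℕ k → ℤ

  _⟨_⟩ : ∀ {k} → Series (suc k) → ℕ → Series k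
  (f ⟨ a ⟩) β = f (a ∷ β)

  infix 9 _⟨_⟩

  -- Multiplication by, and derivative in, the variable of the head (0 if there is none).
  X Δ : ∀ {k} → Series k → Series k
  X f []          = 0ℤ
  X f (zero ∷ β)  = 0ℤ
  X f (suc a ∷ β) = f (a ∷ β)
  Δ f []          = 0ℤ
  Δ f (a ∷ β)     = + suc a * f (suc a ∷ β)

  -- Because the top variable comes first, its index is the length of the tail. The first summand is
  -- k x_{k-1} ∂_k, where `X` multiplies by the head of the tail; the second is the part of the
  -- derivation in the lower variables.
  E : ∀ {k} → Series k → Series k
  E         f []      = 0ℤ
  E {suc k} f (a ∷ β) = + k * (+ suc a * X (f ⟨ suc a ⟩) β) + E (f ⟨ a ⟩) β

  -- c is the coefficient m − i of the topmost term x_{i+1} ∂_i, hence 1 when all variables are present.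
  F : ∀ {k} → ℕ → Series k → Series k
  F c f []          = 0ℤ
  F c f (zero ∷ β)  = F (suc c) (f ⟨ 0 ⟩) β
  F c f (suc a ∷ β) = + c * Δ (f ⟨ a ⟩) β + F (suc c) (f ⟨ suc a ⟩) β

  X-linear : ∀ {k} → Linear (X {k})
  X-linear .cong-≗ f≗g []          = refl
  X-linear .cong-≗ f≗g (zero ∷ β)  = refl
  X-linear .cong-≗ f≗g (suc a ∷ β) = f≗g (a ∷ β)
  X-linear .+-homo f g []          = refl
  X-linear .+-homo f g (zero ∷ β)  = refl
  X-linear .+-homo f g (suc a ∷ β) = refl
  X-linear .*-homo c f []          = sym (*-zeroʳ c)
  X-linear .*-homo c f (zero ∷ β)  = sym (*-zeroʳ c)
  X-linear .*-homo c f (suc a ∷ β) = refl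

  *-swap : ∀ a c x → a * (c * x) ≡ c * (a * x)
  *-swap = solve-∀

  Δ-linear : ∀ {k} → Linear (Δ {k})
  Δ-linear .cong-≗ f≗g []      = refl
  Δ-linear .cong-≗ f≗g (a ∷ β) = cong (+ suc a *_) (f≗g (suc a ∷ β))
  Δ-linear .+-homo f g []      = refl
  Δ-linear .+-homo f g (a ∷ β) = *-distribˡ-+ (+ suc a) (f (suc a ∷ β)) (g (suc a ∷ β))
  Δ-linear .*-homo c f []      = sym (*-zeroʳ c)
  Δ-linear .*-homo c f (a ∷ β) = *-swap (+ suc a) c _

  E-linear : ∀ {k} → Linear (E {k})
  E-linear .cong-≗ f≗g []      = refl
  E-linear {suc k} .cong-≗ f≗g (a ∷ β) =
    cong₂ (λ x y → + k * (+ suc a * x) + y)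
      (X-linear .cong-≗ (λ γ → f≗g (suc a ∷ γ)) β) (E-linear .cong-≗ (λ γ → f≗g (a ∷ γ)) β)
  E-linear .+-homo f g []      = refl
  E-linear {suc k} .+-homo f g (a ∷ β) =
    trans (cong₂ (λ x y → + k * (+ suc a * x) + y)
            (X-linear .+-homo (f ⟨ suc a ⟩) (g ⟨ suc a ⟩) β) (E-linear .+-homo (f ⟨ a ⟩) (g ⟨ a ⟩) β))
          (distrib (+ k) (+ suc a) _ _ _ _)
    where
    distrib : ∀ k a x y z w → k * (a * (x + y)) + (z + w) ≡ (k * (a * x) + z) + (k * (a * y) + w)
    distrib = solve-∀
  E-linear .*-homo c f []      = sym (*-zeroʳ c)
  E-linear {suc k} .*-homo c f (a ∷ β) =
    trans (cong₂ (λ x y → + k * (+ suc a * x) + y)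
            (X-linear .*-homo c (f ⟨ suc a ⟩) β) (E-linear .*-homo c (f ⟨ a ⟩) β))
          (factor (+ k) (+ suc a) c _ _)
    where
    factor : ∀ k a c x y → k * (a * (c * x)) + c * y ≡ c * (k * (a * x) + y)
    factor = solve-∀

  F-linear : ∀ {k} c → Linear (F {k} c)
  F-linear c .cong-≗ f≗g []          = refl
  F-linear c .cong-≗ f≗g (zero ∷ β)  = F-linear (suc c) .cong-≗ (λ γ → f≗g (0 ∷ γ)) β
  F-linear c .cong-≗ f≗g (suc a ∷ β) =
    cong₂ (λ x y → + c * x + y)
      (Δ-linear .cong-≗ (λ γ → f≗g (a ∷ γ)) β) (F-linear (suc c) .cong-≗ (λ γ → f≗g (suc a ∷ γ)) β)
  F-linear c .+-homo f g []          = refl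
  F-linear c .+-homo f g (zero ∷ β)  = F-linear (suc c) .+-homo (f ⟨ 0 ⟩) (g ⟨ 0 ⟩) β
  F-linear c .+-homo f g (suc a ∷ β) =
    trans (cong₂ (λ x y → + c * x + y)
            (Δ-linear .+-homo (f ⟨ a ⟩) (g ⟨ a ⟩) β) (F-linear (suc c) .+-homo (f ⟨ suc a ⟩) (g ⟨ suc a ⟩) β))
          (distrib (+ c) _ _ _ _)
    where
    distrib : ∀ c x y z w → c * (x + y) + (z + w) ≡ (c * x + z) + (c * y + w)
    distrib = solve-∀
  F-linear c .*-homo d f []          = sym (*-zeroʳ d)
  F-linear c .*-homo d f (zero ∷ β)  = F-linear (suc c) .*-homo d (f ⟨ 0 ⟩) β
  F-linear c .*-homo d f (suc a ∷ β) =
    trans (cong₂ (λ x y → + c * x + y)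
            (Δ-linear .*-homo d (f ⟨ a ⟩) β) (F-linear (suc c) .*-homo d (f ⟨ suc a ⟩) β))
          (factor (+ c) d _ _)
    where
    factor : ∀ c d x y → c * (d * x) + d * y ≡ d * (c * x + y)
    factor = solve-∀

  -- The commutator of E and F

  ΔX : ∀ {k} (f : Series (suc k)) β → Δ (X f) β ≡ X (Δ f) β + f β
  ΔX f (zero ∷ β)  = trans (*-identityˡ _) (sym (+-identityˡ _))
  ΔX f (suc b ∷ β) = expand (+ suc b) (f (suc b ∷ β))
    where
    expand : ∀ b x → (1ℤ + b) * x ≡ b * x + x
    expand = solve-∀

  -- No term i x_{i-1} ∂_i multiplies by the top variable, so differentiation in it commutes with
  -- `E`.
  EΔ : ∀ {k} (f : Series k) β → E (Δ f) β ≡ Δ (E f) β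
  EΔ f [] = refl
  EΔ {suc k} f (b ∷ β) =
    trans (cong₂ (λ x y → + k * (+ suc b * x) + y)
            (X-linear .*-homo (+ suc (suc b)) (f ⟨ suc (suc b) ⟩) β) (E-linear .*-homo (+ suc b) (f ⟨ suc b ⟩) β))
          (factor (+ k) (+ suc b) (+ suc (suc b)) _ _)
    where
    factor : ∀ k b b′ x y → k * (b * (b′ * x)) + b * y ≡ b * (k * (b′ * x) + y)
    factor = solve-∀

  -- No term x_{i+1} ∂_i differentiates in the top variable, so multiplication by it commutes with
  -- `F`.
  FX : ∀ {k} c (f : Series k) β → F c (X f) β ≡ X (F c f) β
  FX c f []               = refl
  FX c f (zero ∷ β)       = vanish (F-linear (suc c)) (λ _ → refl) β
  FX c f (suc zero ∷ β)   =
    trans (cong (λ x → + c * x + F (suc c) (f ⟨ 0 ⟩) β) (vanish Δ-linear (λ _ → refl) β))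
          (trans (cong (_+ F (suc c) (f ⟨ 0 ⟩) β) (*-zeroʳ (+ c))) (+-identityˡ _))
  FX c f (suc (suc b) ∷ β) = refl

  head₀ : ∀ {k} → Vec ℕ k → ℕ
  head₀ []      = 0
  head₀ (a ∷ _) = a

  -- The eigenvalue of [E, F] on a monomial in the form the recursion produces: the commutator of k
  -- x_{k-1} ∂_k and c x_k ∂_{k-1} is k c (x_{k-1} ∂_{k-1} - x_k ∂_k).
  H : ∀ {k} → ℕ → Vec ℕ k → ℤ
  H         c []      = 0ℤ
  H {suc k} c (a ∷ β) = + k * + c * (+ head₀ β + - + a) + H (suc c) β

  XΔ : ∀ {k} (f : Series k) β → X (Δ f) β ≡ + head₀ β * f β
  XΔ f []          = refl
  XΔ f (zero ∷ β)  = refl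
  XΔ f (suc b ∷ β) = refl

  -- The Weyl relation ∂x = x∂ + 1 fails when no variable is left, as `X` and `Δ` are then 0. The
  -- factor k, which `E` provides anyway, makes one formula cover that case.
  k*ΔX : ∀ {k} (f : Series k) β → + k * Δ (X f) β ≡ + k * ((1ℤ + + head₀ β) * f β)
  k*ΔX         f []        = refl
  k*ΔX {suc k} f β@(_ ∷ _) = cong (+ suc k *_) (trans (ΔX f β) (trans (cong (_+ f β) (XΔ f β)) (collect (+ head₀ β) (f β))))
    where
    collect : ∀ b x → b * x + x ≡ (1ℤ + b) * x
    collect = solve-∀

  -- A term of E and a term of F fail to commute only if they are opposite, x_{i-1} ∂_i against x_i
  -- ∂_{i-1}. The head contributes one such pair, the new summand of `H`; the mixed terms cancel by
  -- `FX` and `EΔ`, and the tail is the induction hypothesis at `suc c`.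
  [E,F]≡H : ∀ {k} c (f : Series k) α → E (F c f) α ≡ F c (E f) α + H c α * f α
  [E,F]≡H c f [] = refl
  [E,F]≡H {suc k} c f (zero ∷ β) = begin
    + k * (1ℤ * X (F c f ⟨ 1 ⟩) β) + E (F (suc c) (f ⟨ 0 ⟩)) β
      ≡⟨ cong₂ (λ x y → + k * (1ℤ * x) + y)
           (trans (X-linear .+-homo _ _ β) (cong₂ _+_ (trans (X-linear .*-homo (+ c) _ β) (cong (+ c *_) (XΔ (f ⟨ 0 ⟩) β))) (sym (FX (suc c) (f ⟨ 1 ⟩) β))))
           ([E,F]≡H (suc c) (f ⟨ 0 ⟩) β) ⟩
    + k * (1ℤ * (+ c * (b * f₀) + F (suc c) (X (f ⟨ 1 ⟩)) β)) + (F (suc c) (E (f ⟨ 0 ⟩)) β + H (suc c) β * f₀)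
      ≡⟨ rearrange (+ k) (+ c) b f₀ _ _ _ ⟩
    (+ k * (1ℤ * F (suc c) (X (f ⟨ 1 ⟩)) β) + F (suc c) (E (f ⟨ 0 ⟩)) β) + (+ k * + c * (b + 0ℤ) + H (suc c) β) * f₀
      ≡⟨ cong (_+ (+ k * + c * (b + 0ℤ) + H (suc c) β) * f₀)
           (trans (F-linear (suc c) .+-homo _ _ β)
                  (cong (_+ F (suc c) (E (f ⟨ 0 ⟩)) β)
                    (trans (F-linear (suc c) .*-homo (+ k) _ β) (cong (+ k *_) (F-linear (suc c) .*-homo 1ℤ _ β))))) ⟨
    F c (E f) (0 ∷ β) + H c (0 ∷ β) * f₀ ∎
    where
    open ≡-Reasoning
    b f₀ : ℤ
    b  = + head₀ β
    f₀ = f (0 ∷ β)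
    rearrange : ∀ k c b f₀ x y h →
      k * (1ℤ * (c * (b * f₀) + x)) + (y + h * f₀) ≡ (k * (1ℤ * x) + y) + (k * c * (b + 0ℤ) + h) * f₀
    rearrange = solve-∀
  [E,F]≡H {suc k} c f (suc a ∷ β) = begin
    + k * (a₂ * X (F c f ⟨ suc (suc a) ⟩) β) + E (F c f ⟨ suc a ⟩) β
      ≡⟨ cong₂ (λ x y → + k * (a₂ * x) + y)
           (trans (X-linear .+-homo _ _ β) (cong₂ _+_ (trans (X-linear .*-homo (+ c) _ β) (cong (+ c *_) (XΔ (f ⟨ suc a ⟩) β))) (sym (FX (suc c) (f ⟨ suc (suc a) ⟩) β))))
           (trans (E-linear .+-homo _ _ β) (cong₂ _+_ (trans (E-linear .*-homo (+ c) _ β) (cong (+ c *_) (EΔ (f ⟨ a ⟩) β))) ([E,F]≡H (suc c) (f ⟨ suc a ⟩) β))) ⟩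
    + k * (a₂ * (+ c * (b * f₁) + F (suc c) (X (f ⟨ suc (suc a) ⟩)) β))
      + (+ c * Δ (E (f ⟨ a ⟩)) β + (F (suc c) (E (f ⟨ suc a ⟩)) β + H (suc c) β * f₁))
      ≡⟨ rearrange (+ k) (+ c) (+ a) b f₁ _ _ _ _ ⟩
    (+ c * (a₁ * (+ k * ((1ℤ + b) * f₁)) + Δ (E (f ⟨ a ⟩)) β)
      + (+ k * (a₂ * F (suc c) (X (f ⟨ suc (suc a) ⟩)) β) + F (suc c) (E (f ⟨ suc a ⟩)) β))
      + (+ k * + c * (b + - a₁) + H (suc c) β) * f₁
      ≡⟨ cong₂ (λ x y → (+ c * x + y) + (+ k * + c * (b + - a₁) + H (suc c) β) * f₁)
           (trans (Δ-linear .+-homo _ _ β)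
                  (cong (_+ Δ (E (f ⟨ a ⟩)) β)
                    (trans (Δ-linear .*-homo (+ k) _ β)
                      (trans (cong (+ k *_) (Δ-linear .*-homo a₁ _ β))
                        (trans (*-swap (+ k) a₁ _) (cong (a₁ *_) (k*ΔX (f ⟨ suc a ⟩) β)))))))
           (trans (F-linear (suc c) .+-homo _ _ β)
                  (cong (_+ F (suc c) (E (f ⟨ suc a ⟩)) β)
                    (trans (F-linear (suc c) .*-homo (+ k) _ β) (cong (+ k *_) (F-linear (suc c) .*-homo a₂ _ β))))) ⟨
    F c (E f) (suc a ∷ β) + H c (suc a ∷ β) * f₁ ∎
    where
    open ≡-Reasoning
    a₁ a₂ b f₁ : ℤ
    a₁ = + suc a
    a₂ = + suc (suc a)
    b  = + head₀ β
    f₁ = f (suc a ∷ β)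
    rearrange : ∀ k c a b f x y z h →
      k * ((1ℤ + (1ℤ + a)) * (c * (b * f) + x)) + (c * y + (z + h * f)) ≡
      (c * ((1ℤ + a) * (k * ((1ℤ + b) * f)) + y) + (k * ((1ℤ + (1ℤ + a)) * x) + z)) + (k * c * (b + - (1ℤ + a)) + h) * f
    rearrange = solve-∀

  -- Degree and weight

  weight : ∀ {k} → Vec ℕ k → ℕ
  weight         []      = 0
  weight {suc k} (a ∷ β) = a ℕ.* k ℕ.+ weight β

  -- The effect of an operator on degree and weight, stated as locality: its value at α depends only
  -- on values of `f` in one degree and weight. The top variable has weight k - 1, written
  -- additively to allow k = 0.
  X-local : ∀ {k} (f : Series k) α →
    (∀ β → suc (sum β) ≡ sum α → k ℕ.+ weight β ≡ suc (weight α) → f β ≡ 0ℤ) → X f α ≡ 0ℤ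
  X-local         f []          f≡0 = refl
  X-local         f (zero ∷ α)  f≡0 = refl
  X-local {suc k} f (suc a ∷ α) f≡0 = f≡0 (a ∷ α) refl (cong suc (sym (ℕ.+-assoc k _ _)))

  Δ-local : ∀ {k} (f : Series k) α →
    (∀ β → sum β ≡ suc (sum α) → suc (weight β) ≡ k ℕ.+ weight α → f β ≡ 0ℤ) → Δ f α ≡ 0ℤ
  Δ-local         f []      f≡0 = refl
  Δ-local {suc k} f (a ∷ α) f≡0 =
    trans (cong (+ suc a *_) (f≡0 (suc a ∷ α) refl (cong suc (ℕ.+-assoc k _ _)))) (*-zeroʳ (+ suc a))

  E-local : ∀ {k} (f : Series k) α →
    (∀ β → sum β ≡ sum α → weight β ≡ suc (weight α) → f β ≡ 0ℤ) → E f α ≡ 0ℤ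
  E-local         f []      f≡0 = refl
  E-local {suc k} f (a ∷ α) f≡0 =
    trans (cong₂ (λ x y → + k * (+ suc a * x) + y)
      (X-local (f ⟨ suc a ⟩) α λ β s w → f≡0 (suc a ∷ β)
        (trans (sym (ℕ.+-suc a (sum β))) (cong (a ℕ.+_) s))
        (trans (index k (a ℕ.* k) (weight β)) (trans (cong (a ℕ.* k ℕ.+_) w) (ℕ.+-suc _ _))))
      (E-local (f ⟨ a ⟩) α λ β s w → f≡0 (a ∷ β)
        (cong (a ℕ.+_) s) (trans (cong (a ℕ.* k ℕ.+_) w) (ℕ.+-suc _ _))))
      (zeros (+ k) (+ suc a))
    where
    index : ∀ k x y → (k ℕ.+ x) ℕ.+ y ≡ x ℕ.+ (k ℕ.+ y)
    index = ℕ.solve-∀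
    zeros : ∀ k a → k * (a * 0ℤ) + 0ℤ ≡ 0ℤ
    zeros = solve-∀

  F-local : ∀ {k} c (f : Series k) α →
    (∀ β → sum β ≡ sum α → suc (weight β) ≡ weight α → f β ≡ 0ℤ) → F c f α ≡ 0ℤ
  F-local c f []          f≡0 = refl
  F-local c f (zero ∷ α)  f≡0 = F-local (suc c) (f ⟨ 0 ⟩) α λ β s w → f≡0 (0 ∷ β) s w
  F-local {suc k} c f (suc a ∷ α) f≡0 =
    trans (cong₂ (λ x y → + c * x + y)
      (Δ-local (f ⟨ a ⟩) α λ β s w → f≡0 (a ∷ β)
        (trans (cong (a ℕ.+_) s) (ℕ.+-suc a _))
        (trans (sym (ℕ.+-suc _ (weight β))) (trans (cong (a ℕ.* k ℕ.+_) w) (index k (a ℕ.* k) (weight α)))))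
      (F-local (suc c) (f ⟨ suc a ⟩) α λ β s w → f≡0 (suc a ∷ β)
        (cong (suc a ℕ.+_) s) (trans (sym (ℕ.+-suc _ (weight β))) (cong (suc a ℕ.* k ℕ.+_) w))))
      (zeros (+ c))
    where
    index : ∀ k x y → x ℕ.+ (k ℕ.+ y) ≡ (k ℕ.+ x) ℕ.+ y
    index = ℕ.solve-∀
    zeros : ∀ c → c * 0ℤ + 0ℤ ≡ 0ℤ
    zeros = solve-∀

  -- Homogeneity in degree and weight. Only finitely many monomials qualify, so this is also what
  -- makes a series a polynomial.
  Supported : ∀ {k} → Series k → ℕ → ℕ → Set
  Supported f d w = ∀ α → ¬ (sum α ≡ d × weight α ≡ w) → f α ≡ 0ℤ

  E-Supported : ∀ {k} {f : Series k} {d w} → Supported f d (suc w) → Supported (E f) d w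
  E-Supported {f = f} supp α α∉ = E-local f α λ β s w → supp β λ (s′ , w′) →
    α∉ (trans (sym s) s′ , ℕ.suc-injective (trans (sym w) w′))

  E-Supported-0 : ∀ {k} {f : Series k} {d} → Supported f d 0 → ∀ α → E f α ≡ 0ℤ
  E-Supported-0 {f = f} supp α = E-local f α λ β s w → supp β λ (_ , w′) → ℕ.1+n≢0 (trans (sym w) w′)

  F-Supported : ∀ {k} {f : Series k} c {d w} → Supported f d w → Supported (F c f) d (suc w)
  F-Supported {f = f} c supp α α∉ = F-local c f α λ β s w → supp β λ (s′ , w′) →
    α∉ (trans (sym s) s′ , trans (sym w) (cong suc w′))

  -- H 1 α = k deg α − 2 weight α, generalised to a larger initial coefficient 1 + d.
  H-weight : ∀ {k} d (α : Vec ℕ (suc k)) →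
    H (suc d) α + + 2 * + weight α + + suc k * + d * + head₀ α ≡ (+ d + + k) * + sum α
  H-weight d (a ∷ []) = begin
    0ℤ * + suc d * (0ℤ + - + a) + 0ℤ + + 2 * + (a ℕ.* 0 ℕ.+ 0) + 1ℤ * + d * + a
      ≡⟨ cong (λ w → 0ℤ * + suc d * (0ℤ + - + a) + 0ℤ + + 2 * + w + 1ℤ * + d * + a) (trans (ℕ.+-identityʳ _) (ℕ.*-zeroʳ a)) ⟩
    0ℤ * + suc d * (0ℤ + - + a) + 0ℤ + + 2 * 0ℤ + 1ℤ * + d * + a
      ≡⟨ simplify (+ d) (+ a) ⟩
    (+ d + 0ℤ) * (+ a + 0ℤ) ∎
    where
    open ≡-Reasoning
    simplify : ∀ d a → 0ℤ * (1ℤ + d) * (0ℤ + - a) + 0ℤ + + 2 * 0ℤ + 1ℤ * d * a ≡ (d + 0ℤ) * (a + 0ℤ)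
    simplify = solve-∀
  H-weight {suc k} d (a ∷ β@(b ∷ _)) = begin
    K * + suc d * (+ b + - + a) + H (suc (suc d)) β + + 2 * + (a ℕ.* suc k ℕ.+ weight β) + + suc (suc k) * + d * + a
      ≡⟨ cong (λ w → K * + suc d * (+ b + - + a) + H (suc (suc d)) β + + 2 * w + + suc (suc k) * + d * + a)
           (trans (pos-+ (a ℕ.* suc k) (weight β)) (cong (_+ + weight β) (pos-* a (suc k)))) ⟩
    K * + suc d * (+ b + - + a) + H (suc (suc d)) β + + 2 * (+ a * K + + weight β) + + suc (suc k) * + d * + a
      ≡⟨ regroup (+ k) (+ d) (+ a) (+ b) (H (suc (suc d)) β) (+ weight β) ⟩
    (H (suc (suc d)) β + + 2 * + weight β + K * + suc d * + b) + (+ d + K) * + a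
      ≡⟨ cong (_+ (+ d + K) * + a) (H-weight (suc d) β) ⟩
    (+ suc d + + k) * + sum β + (+ d + K) * + a
      ≡⟨ collect (+ k) (+ d) (+ a) (+ sum β) ⟩
    (+ d + K) * (+ a + + sum β)
      ≡⟨ cong ((+ d + K) *_) (pos-+ a (sum β)) ⟨
    (+ d + K) * + sum (a ∷ β) ∎
    where
    open ≡-Reasoning
    K : ℤ
    K = + suc k
    regroup : ∀ k d a b h w →
      (1ℤ + k) * (1ℤ + d) * (b + - a) + h + + 2 * (a * (1ℤ + k) + w) + (1ℤ + (1ℤ + k)) * d * a ≡
      (h + + 2 * w + (1ℤ + k) * (1ℤ + d) * b) + (d + (1ℤ + k)) * a
    regroup = solve-∀
    collect : ∀ k d a s → ((1ℤ + d) + k) * s + (d + (1ℤ + k)) * a ≡ (d + (1ℤ + k)) * (a + s)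
    collect = solve-∀

  H-Supported : ∀ {m} {f : Series (suc m)} {d w h} → Supported f d w → m ℕ.* d ≡ 2 ℕ.* w ℕ.+ h →
    ∀ α → H 1 α * f α ≡ + h * f α
  H-Supported {m} {f} {d} {w} {h} supp eq α with sum α ℕ.≟ d ×-dec weight α ℕ.≟ w
  ... | no α∉ = trans (cong (H 1 α *_) (supp α α∉)) (trans (*-zeroʳ (H 1 α)) (sym (trans (cong (+ h *_) (supp α α∉)) (*-zeroʳ (+ h)))))
  ... | yes (refl , refl) = cong (_* f α) (begin
    H 1 α                                                                         ≡⟨ isolate (H 1 α) (+ weight α) (+ suc m) (+ head₀ α) ⟩
    (H 1 α + + 2 * + weight α + + suc m * 0ℤ * + head₀ α) + - (+ 2 * + weight α)  ≡⟨ cong (_+ - (+ 2 * + weight α)) (H-weight 0 α) ⟩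
    (0ℤ + + m) * + sum α + - (+ 2 * + weight α)                                   ≡⟨ cong (λ x → x * + sum α + - (+ 2 * + weight α)) (+-identityˡ (+ m)) ⟩
    + m * + sum α + - (+ 2 * + weight α)                                          ≡⟨ cong (_+ - (+ 2 * + weight α)) eqℤ ⟩
    (+ 2 * + weight α + + h) + - (+ 2 * + weight α)                               ≡⟨ cancel (+ 2 * + weight α) (+ h) ⟩
    + h                                                                           ∎)
    where
    open ≡-Reasoning
    isolate : ∀ h w k b → h ≡ (h + + 2 * w + k * 0ℤ * b) + - (+ 2 * w)
    isolate = solve-∀
    cancel : ∀ x h → (x + h) + - x ≡ h
    cancel = solve-∀
    eqℤ : + m * + sum α ≡ + 2 * + weight α + + h
    eqℤ = trans (sym (pos-* m (sum α))) (trans (cong +_ eq) (trans (pos-+ (2 ℕ.* weight α) h) (cong (_+ + h) (pos-* 2 (weight α)))))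

  pos-cancel : ∀ n {x} → + suc n * x ≡ 0ℤ → x ≡ 0ℤ
  pos-cancel n {x} eq with i*j≡0⇒i≡0∨j≡0 (+ suc n) eq
  ... | inj₂ x≡0 = x≡0

  -- If E F f = − c f then F (E f) = − (c + H) f, so g = E f satisfies the same kind of equation
  -- E F g = − (c + H) g one weight lower, where H is even larger.
  EF-negative⇒0 : ∀ {m} w {d h} c (f : Series (suc m)) → Supported f d w → m ℕ.* d ≡ 2 ℕ.* w ℕ.+ suc h →
    (∀ α → E (F 1 f) α + + c * f α ≡ 0ℤ) → ∀ α → f α ≡ 0ℤ
  EF-negative⇒0 {m} w {d} {h} c f supp eq EF α =
    pos-cancel (h ℕ.+ c) (trans (sym (+-identityˡ _)) (trans (cong (_+ _) (sym (vanish (F-linear 1) (Ef≡0 w supp eq) α))) (FE α)))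
    where
    split : ∀ x h c y → x + (h + c) * y ≡ (x + h * y) + c * y
    split = solve-∀
    FE : ∀ α → F 1 (E f) α + + (suc h ℕ.+ c) * f α ≡ 0ℤ
    FE α = begin
      F 1 (E f) α + + (suc h ℕ.+ c) * f α          ≡⟨ cong (λ x → F 1 (E f) α + x * f α) (pos-+ (suc h) c) ⟩
      F 1 (E f) α + (+ suc h + + c) * f α          ≡⟨ split (F 1 (E f) α) (+ suc h) (+ c) (f α) ⟩
      (F 1 (E f) α + + suc h * f α) + + c * f α    ≡⟨ cong (λ x → (F 1 (E f) α + x) + + c * f α) (H-Supported supp eq α) ⟨
      (F 1 (E f) α + H 1 α * f α) + + c * f α      ≡⟨ cong (_+ + c * f α) ([E,F]≡H 1 f α) ⟨
      E (F 1 f) α + + c * f α                      ≡⟨ EF α ⟩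
      0ℤ                                           ∎
      where open ≡-Reasoning
    index : ∀ w h → 2 ℕ.* (1 ℕ.+ w) ℕ.+ (1 ℕ.+ h) ≡ 2 ℕ.* w ℕ.+ (1 ℕ.+ (2 ℕ.+ h))
    index = ℕ.solve-∀
    Ef≡0 : ∀ w → Supported f d w → m ℕ.* d ≡ 2 ℕ.* w ℕ.+ suc h → ∀ α → E f α ≡ 0ℤ
    Ef≡0 zero    supp eq = E-Supported-0 supp
    Ef≡0 (suc w) supp eq = EF-negative⇒0 w (suc h ℕ.+ c) (E f) (E-Supported supp) (trans eq (index w h)) λ α →
      trans (cong (λ x → E (F 1 (E f)) α + x) (sym (E-linear .*-homo (+ (suc h ℕ.+ c)) f α)))
        (trans (sym (E-linear .+-homo _ _ α)) (vanish E-linear FE α))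

  -- Products of series

  conv : ℕ → (ℕ → ℕ → ℤ) → ℤ
  conv zero    c = c 0 0
  conv (suc n) c = c 0 (suc n) + conv n (λ i j → c (suc i) j)

  conv-cong : ∀ n {c d} → (∀ i j → i ℕ.+ j ≡ n → c i j ≡ d i j) → conv n c ≡ conv n d
  conv-cong zero    c≡d = c≡d 0 0 refl
  conv-cong (suc n) c≡d = cong₂ _+_ (c≡d 0 (suc n) refl) (conv-cong n λ i j eq → c≡d (suc i) j (cong suc eq))

  conv-+ : ∀ n c d → conv n (λ i j → c i j + d i j) ≡ conv n c + conv n d
  conv-+ zero    c d = refl
  conv-+ (suc n) c d =
    trans (cong (λ z → (c 0 (suc n) + d 0 (suc n)) + z) (conv-+ n (λ i j → c (suc i) j) (λ i j → d (suc i) j)))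
          (interchange (c 0 (suc n)) (d 0 (suc n)) _ _)
    where
    interchange : ∀ x y z w → (x + y) + (z + w) ≡ (x + z) + (y + w)
    interchange = solve-∀

  conv-* : ∀ n x c → conv n (λ i j → x * c i j) ≡ x * conv n c
  conv-* zero    x c = refl
  conv-* (suc n) x c =
    trans (cong (λ z → x * c 0 (suc n) + z) (conv-* n x _)) (sym (*-distribˡ-+ x (c 0 (suc n)) _))

  conv-vanish : ∀ n {c} → (∀ i j → i ℕ.+ j ≡ n → c i j ≡ 0ℤ) → conv n c ≡ 0ℤ
  conv-vanish zero    c≡0 = c≡0 0 0 refl
  conv-vanish (suc n) c≡0 = cong₂ _+_ (c≡0 0 (suc n) refl) (conv-vanish n λ i j eq → c≡0 (suc i) j (cong suc eq))

  conv-last : ∀ n c → conv (suc n) c ≡ conv n (λ i j → c i (suc j)) + c (suc n) 0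
  conv-last zero    c = refl
  conv-last (suc n) c =
    trans (cong (λ z → c 0 (suc (suc n)) + z) (conv-last n (λ i j → c (suc i) j))) (sym (+-assoc (c 0 (suc (suc n))) _ _))

  -- Any other pair on the antidiagonal is smaller than (i, j) in one of its entries. This isolates
  -- the product of the lowest terms of two series.
  conv-single : ∀ i j c → (∀ i′ j′ → i′ ℕ.+ j′ ≡ i ℕ.+ j → i′ ℕ.< i ⊎ j′ ℕ.< j → c i′ j′ ≡ 0ℤ) →
    conv (i ℕ.+ j) c ≡ c i j
  conv-single zero    zero    c c≡0 = refl
  conv-single zero    (suc j) c c≡0 =
    trans (cong (λ z → c 0 (suc j) + z) (conv-vanish j λ i′ j′ eq →
      c≡0 (suc i′) j′ (cong suc eq) (inj₂ (s≤s (subst (j′ ℕ.≤_) eq (ℕ.m≤n+m j′ i′))))))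
      (+-identityʳ _)
  conv-single (suc i) j c c≡0 =
    trans (cong₂ _+_ (c≡0 0 (suc (i ℕ.+ j)) refl (inj₁ z<s))
      (conv-single i j (λ i j → c (suc i) j) λ
        { i′ j′ eq (inj₁ i′<i) → c≡0 (suc i′) j′ (cong suc eq) (inj₁ (s≤s i′<i))
        ; i′ j′ eq (inj₂ j′<j) → c≡0 (suc i′) j′ (cong suc eq) (inj₂ j′<j) }))
      (+-identityˡ _)

  -- The coefficient of x ^ n in (f g)′ = f′ g + f g′, where c i j stands for f_i g_j.
  conv-Leibniz : ∀ n c → + suc n * conv (suc n) c ≡
    conv n (λ i j → + suc i * c (suc i) j) + conv n (λ i j → + suc j * c i (suc j))
  conv-Leibniz n c = begin
    + suc n * conv (suc n) c                                                        ≡⟨ conv-* (suc n) (+ suc n) c ⟨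
    conv (suc n) (λ i j → + suc n * c i j)                                          ≡⟨ conv-cong (suc n) split ⟩
    conv (suc n) (λ i j → + i * c i j + + j * c i j)                                ≡⟨ conv-+ (suc n) (λ i j → + i * c i j) (λ i j → + j * c i j) ⟩
    conv (suc n) (λ i j → + i * c i j) + conv (suc n) (λ i j → + j * c i j)         ≡⟨ cong₂ _+_ (+-identityˡ (conv n λ i j → + suc i * c (suc i) j)) (trans (conv-last n (λ i j → + j * c i j)) (+-identityʳ _)) ⟩
    conv n (λ i j → + suc i * c (suc i) j) + conv n (λ i j → + suc j * c i (suc j)) ∎
    where
    open ≡-Reasoning
    split : ∀ i j → i ℕ.+ j ≡ suc n → + suc n * c i j ≡ + i * c i j + + j * c i j
    split i j eq = trans (cong (_* c i j) (trans (cong +_ (sym eq)) (pos-+ i j))) (*-distribʳ-+ (c i j) (+ i) (+ j))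

  Linear-conv : ∀ {A B : Set} {T : (A → ℤ) → B → ℤ} → Linear T → ∀ n (h : ℕ → ℕ → A → ℤ) y →
    T (λ x → conv n (λ i j → h i j x)) y ≡ conv n (λ i j → T (h i j) y)
  Linear-conv T-linear zero    h y = refl
  Linear-conv {T = T} T-linear (suc n) h y =
    trans (T-linear .+-homo _ _ y) (cong (λ z → T (h 0 (suc n)) y + z) (Linear-conv T-linear n (λ i j → h (suc i) j) y))

  infixl 7 _⊛_

  _⊛_ : ∀ {k} → Series k → Series k → Series k
  (f ⊛ g) []      = f [] * g []
  (f ⊛ g) (n ∷ γ) = conv n (λ i j → (f ⟨ i ⟩ ⊛ g ⟨ j ⟩) γ)

  ⊛-linearˡ : ∀ {k} (g : Series k) → Linear (_⊛ g)
  ⊛-linearˡ g .cong-≗ f≗f′ []       = cong (_* g []) (f≗f′ [])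
  ⊛-linearˡ g .cong-≗ f≗f′ (n ∷ γ)  = conv-cong n λ i j _ → ⊛-linearˡ (g ⟨ j ⟩) .cong-≗ (λ α → f≗f′ (i ∷ α)) γ
  ⊛-linearˡ g .+-homo f f′ []       = *-distribʳ-+ (g []) (f []) (f′ [])
  ⊛-linearˡ g .+-homo f f′ (n ∷ γ)  =
    trans (conv-cong n λ i j _ → ⊛-linearˡ (g ⟨ j ⟩) .+-homo (f ⟨ i ⟩) (f′ ⟨ i ⟩) γ) (conv-+ n _ _)
  ⊛-linearˡ g .*-homo c f []        = *-assoc c (f []) (g [])
  ⊛-linearˡ g .*-homo c f (n ∷ γ)   =
    trans (conv-cong n λ i j _ → ⊛-linearˡ (g ⟨ j ⟩) .*-homo c (f ⟨ i ⟩) γ) (conv-* n c _)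

  ⊛-linearʳ : ∀ {k} (f : Series k) → Linear (f ⊛_)
  ⊛-linearʳ f .cong-≗ g≗g′ []       = cong (f [] *_) (g≗g′ [])
  ⊛-linearʳ f .cong-≗ g≗g′ (n ∷ γ)  = conv-cong n λ i j _ → ⊛-linearʳ (f ⟨ i ⟩) .cong-≗ (λ α → g≗g′ (j ∷ α)) γ
  ⊛-linearʳ f .+-homo g g′ []       = *-distribˡ-+ (f []) (g []) (g′ [])
  ⊛-linearʳ f .+-homo g g′ (n ∷ γ)  =
    trans (conv-cong n λ i j _ → ⊛-linearʳ (f ⟨ i ⟩) .+-homo (g ⟨ j ⟩) (g′ ⟨ j ⟩) γ) (conv-+ n _ _)
  ⊛-linearʳ f .*-homo c g []        = *-swap (f []) c (g [])
  ⊛-linearʳ f .*-homo c g (n ∷ γ)   =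
    trans (conv-cong n λ i j _ → ⊛-linearʳ (f ⟨ i ⟩) .*-homo c (g ⟨ j ⟩) γ) (conv-* n c _)

  X-⊛ˡ : ∀ {k} (f g : Series k) γ → X (f ⊛ g) γ ≡ (X f ⊛ g) γ
  X-⊛ˡ f g []          = refl
  X-⊛ˡ f g (zero ∷ γ)  = sym (vanish (⊛-linearˡ (g ⟨ 0 ⟩)) (λ _ → refl) γ)
  X-⊛ˡ f g (suc n ∷ γ) = sym (trans (cong (_+ (f ⊛ g) (n ∷ γ)) (vanish (⊛-linearˡ (g ⟨ suc n ⟩)) (λ _ → refl) γ)) (+-identityˡ _))

  X-⊛ʳ : ∀ {k} (f g : Series k) γ → X (f ⊛ g) γ ≡ (f ⊛ X g) γ
  X-⊛ʳ f g []          = sym (*-zeroʳ (f []))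
  X-⊛ʳ f g (zero ∷ γ)  = sym (vanish (⊛-linearʳ (f ⟨ 0 ⟩)) (λ _ → refl) γ)
  X-⊛ʳ f g (suc n ∷ γ) = sym (trans (conv-last n (λ i j → (f ⟨ i ⟩ ⊛ X g ⟨ j ⟩) γ))
    (trans (cong (λ z → (f ⊛ g) (n ∷ γ) + z) (vanish (⊛-linearʳ (f ⟨ suc n ⟩)) (λ _ → refl) γ)) (+-identityʳ _)))

  -- In the head variable this is `conv-Leibniz`; the multiplication by x_{k-1} can be attached to
  -- whichever factor was differentiated, by `X-⊛ˡ` and `X-⊛ʳ`. The lower variables follow by
  -- induction.
  E-⊛ : ∀ {k} (f g : Series k) γ → E (f ⊛ g) γ ≡ (E f ⊛ g) γ + (f ⊛ E g) γ
  E-⊛ f g [] = sym (trans (+-identityˡ _) (*-zeroʳ (f [])))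
  E-⊛ {suc k} f g (n ∷ γ) = begin
    K * (+ suc n * X ((f ⊛ g) ⟨ suc n ⟩) γ) + E ((f ⊛ g) ⟨ n ⟩) γ
      ≡⟨ cong₂ (λ x y → K * (+ suc n * x) + y)
           (Linear-conv X-linear (suc n) (λ i j → f ⟨ i ⟩ ⊛ g ⟨ j ⟩) γ)
           (trans (Linear-conv E-linear n (λ i j → f ⟨ i ⟩ ⊛ g ⟨ j ⟩) γ)
             (trans (conv-cong n λ i j _ → E-⊛ (f ⟨ i ⟩) (g ⟨ j ⟩) γ) (conv-+ n _ _))) ⟩
    K * (+ suc n * conv (suc n) c) + (conv n x + conv n y)
      ≡⟨ cong (λ z → K * z + (conv n x + conv n y)) (conv-Leibniz n c) ⟩
    K * (conv n c₁ + conv n c₂) + (conv n x + conv n y)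
      ≡⟨ rearrange K (conv n c₁) (conv n c₂) (conv n x) (conv n y) ⟩
    (K * conv n c₁ + conv n x) + (K * conv n c₂ + conv n y)
      ≡⟨ cong₂ _+_ (trans (conv-+ n _ x) (cong (_+ conv n x) (conv-* n K c₁))) (trans (conv-+ n _ y) (cong (_+ conv n y) (conv-* n K c₂))) ⟨
    conv n (λ i j → K * c₁ i j + x i j) + conv n (λ i j → K * c₂ i j + y i j)
      ≡⟨ cong₂ _+_
           (conv-cong n λ i j _ → trans (⊛-linearˡ (g ⟨ j ⟩) .+-homo _ _ γ)
             (cong (_+ x i j) (trans (⊛-linearˡ (g ⟨ j ⟩) .*-homo K _ γ)
               (cong (K *_) (trans (⊛-linearˡ (g ⟨ j ⟩) .*-homo (+ suc i) _ γ)
                 (cong (+ suc i *_) (sym (X-⊛ˡ (f ⟨ suc i ⟩) (g ⟨ j ⟩) γ))))))))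
           (conv-cong n λ i j _ → trans (⊛-linearʳ (f ⟨ i ⟩) .+-homo _ _ γ)
             (cong (_+ y i j) (trans (⊛-linearʳ (f ⟨ i ⟩) .*-homo K _ γ)
               (cong (K *_) (trans (⊛-linearʳ (f ⟨ i ⟩) .*-homo (+ suc j) _ γ)
                 (cong (+ suc j *_) (sym (X-⊛ʳ (f ⟨ i ⟩) (g ⟨ suc j ⟩) γ)))))))) ⟨
    (E f ⊛ g) (n ∷ γ) + (f ⊛ E g) (n ∷ γ) ∎
    where
    open ≡-Reasoning
    K : ℤ
    K = + k
    c c₁ c₂ x y : ℕ → ℕ → ℤ
    c  i j = X (f ⟨ i ⟩ ⊛ g ⟨ j ⟩) γ
    c₁ i j = + suc i * c (suc i) j
    c₂ i j = + suc j * c i (suc j)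
    x  i j = (E (f ⟨ i ⟩) ⊛ g ⟨ j ⟩) γ
    y  i j = (f ⟨ i ⟩ ⊛ E (g ⟨ j ⟩)) γ
    rearrange : ∀ k a b x y → k * (a + b) + (x + y) ≡ (k * a + x) + (k * b + y)
    rearrange = solve-∀

  ⊛-local : ∀ {k} (f g : Series k) γ →
    (∀ α β → sum α ℕ.+ sum β ≡ sum γ → weight α ℕ.+ weight β ≡ weight γ → f α ≡ 0ℤ ⊎ g β ≡ 0ℤ) →
    (f ⊛ g) γ ≡ 0ℤ
  ⊛-local f g [] fg≡0 with fg≡0 [] [] refl refl
  ... | inj₁ f≡0 = cong (_* g []) f≡0
  ... | inj₂ g≡0 = trans (cong (f [] *_) g≡0) (*-zeroʳ (f []))
  ⊛-local {suc k} f g (n ∷ γ) fg≡0 = conv-vanish n λ i j eq → ⊛-local (f ⟨ i ⟩) (g ⟨ j ⟩) γ λ α β s w →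
    fg≡0 (i ∷ α) (j ∷ β)
      (trans (interchange i (sum α) j (sum β)) (cong₂ ℕ._+_ eq s))
      (trans (interchange (i ℕ.* k) (weight α) (j ℕ.* k) (weight β))
        (cong₂ ℕ._+_ (trans (sym (ℕ.*-distribʳ-+ k i j)) (cong (ℕ._* k) eq)) w))
    where
    interchange : ∀ x y z w → (x ℕ.+ y) ℕ.+ (z ℕ.+ w) ≡ (x ℕ.+ z) ℕ.+ (y ℕ.+ w)
    interchange = ℕ.solve-∀

  ⊛-Supported : ∀ {k} {f g : Series k} {d d′ w w′} → Supported f d w → Supported g d′ w′ →
    Supported (f ⊛ g) (d ℕ.+ d′) (w ℕ.+ w′)
  ⊛-Supported {f = f} {g} {d} {d′} {w} {w′} f-supp g-supp γ γ∉ = ⊛-local f g γ zero-factor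
    where
    zero-factor : ∀ α β → sum α ℕ.+ sum β ≡ sum γ → weight α ℕ.+ weight β ≡ weight γ → f α ≡ 0ℤ ⊎ g β ≡ 0ℤ
    zero-factor α β s v with sum α ℕ.≟ d ×-dec weight α ℕ.≟ w | sum β ℕ.≟ d′ ×-dec weight β ℕ.≟ w′
    ... | no α∉             | _                 = inj₁ (f-supp α α∉)
    ... | yes _             | no β∉             = inj₂ (g-supp β β∉)
    ... | yes (refl , refl) | yes (refl , refl) = contradiction (sym s , sym v) γ∉

  -- The least first exponents occurring in f and in g add up to one that occurs in f ⊛ g.
  ⊛-cancelʳ : ∀ {k} (f g : Series k) → (∀ γ → (f ⊛ g) γ ≡ 0ℤ) → ∃ (λ β → g β ≢ 0ℤ) → ∀ α → f α ≡ 0ℤ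
  ⊛-cancelʳ f g fg≡0 ([] , g≢0) [] with i*j≡0⇒i≡0∨j≡0 (f []) (fg≡0 [])
  ... | inj₁ f≡0 = f≡0
  ... | inj₂ g≡0 = contradiction g≡0 g≢0
  ⊛-cancelʳ f g fg≡0 (b ∷ β , g≢0) (a ∷ α) = <-rec _ f-step a α
    where
    g-step : ∀ i → (∀ {i′} → i′ ℕ.< i → ∀ α → f (i′ ∷ α) ≡ 0ℤ) → ∃ (λ α → f (i ∷ α) ≢ 0ℤ) →
      ∀ j → (∀ {j′} → j′ ℕ.< j → ∀ β → g (j′ ∷ β) ≡ 0ℤ) → ∀ β → g (j ∷ β) ≡ 0ℤ
    g-step i f-below (α , f≢0) j g-below β with g (j ∷ β) ≟ 0ℤ
    ... | yes g≡0 = g≡0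
    ... | no  g≢0 = contradiction (⊛-cancelʳ (f ⟨ i ⟩) (g ⟨ j ⟩) lowest (β , g≢0) α) f≢0
      where
      lowest : ∀ γ → (f ⟨ i ⟩ ⊛ g ⟨ j ⟩) γ ≡ 0ℤ
      lowest γ = trans (sym (conv-single i j (λ i j → (f ⟨ i ⟩ ⊛ g ⟨ j ⟩) γ) λ
        { i′ j′ _ (inj₁ i′<i) → vanish (⊛-linearˡ (g ⟨ j′ ⟩)) (f-below i′<i) γ
        ; i′ j′ _ (inj₂ j′<j) → vanish (⊛-linearʳ (f ⟨ i′ ⟩)) (g-below j′<j) γ })) (fg≡0 (i ℕ.+ j ∷ γ))
    f-step : ∀ i → (∀ {i′} → i′ ℕ.< i → ∀ α → f (i′ ∷ α) ≡ 0ℤ) → ∀ α → f (i ∷ α) ≡ 0ℤ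
    f-step i f-below α with f (i ∷ α) ≟ 0ℤ
    ... | yes f≡0 = f≡0
    ... | no  f≢0 = contradiction (<-rec _ (g-step i f-below (α , f≢0)) b β) g≢0

  -- Linear algebra over the integers

  comb : ∀ {A : Set} {n} → Vec ℤ n → Vec (A → ℤ) n → A → ℤ
  comb []       []       x = 0ℤ
  comb (c ∷ cs) (g ∷ gs) x = c * g x + comb cs gs x

  Linear-comb : ∀ {A B : Set} {T : (A → ℤ) → B → ℤ} → Linear T → ∀ {n} (cs : Vec ℤ n) gs y →
    T (comb cs gs) y ≡ comb cs (Vec.map T gs) y
  Linear-comb T-linear []       []       y = vanish T-linear (λ _ → refl) y
  Linear-comb T-linear (c ∷ cs) (g ∷ gs) y =
    trans (T-linear .+-homo _ _ y) (cong₂ _+_ (T-linear .*-homo c g y) (Linear-comb T-linear cs gs y))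

  Nonzero : ∀ {n} → Vec ℤ n → Set
  Nonzero = VAny.Any (_≢ 0ℤ)

  comb-scale : ∀ {A : Set} {n} q (cs : Vec ℤ n) (gs : Vec (A → ℤ) n) y → comb (Vec.map (q *_) cs) gs y ≡ q * comb cs gs y
  comb-scale q []       []       y = sym (*-zeroʳ q)
  comb-scale q (c ∷ cs) (g ∷ gs) y = trans (cong (λ z → q * c * g y + z) (comb-scale q cs gs y)) (factor q c (g y) _)
    where
    factor : ∀ q c x z → q * c * x + q * z ≡ q * (c * x + z)
    factor = solve-∀

  -- The pivot step without division: with q = g x, each h is replaced by q h - h(x) g, which
  -- vanishes at x.
  comb-pivot : ∀ {A : Set} {n} q (g : A → ℤ) x (cs : Vec ℤ n) gs y →
    comb cs (Vec.map (λ h y → q * h y + - h x * g y) gs) y ≡ q * comb cs gs y + - comb cs gs x * g y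
  comb-pivot q g x []       []       y = zeros q (g y)
    where
    zeros : ∀ q z → 0ℤ ≡ q * 0ℤ + - 0ℤ * z
    zeros = solve-∀
  comb-pivot q g x (c ∷ cs) (h ∷ gs) y =
    trans (cong (λ z → c * (q * h y + - h x * g y) + z) (comb-pivot q g x cs gs y))
          (regroup c q (h y) (h x) (g y) _ _)
    where
    regroup : ∀ c q hy hx gy u v → c * (q * hy + - hx * gy) + (q * u + - v * gy) ≡ q * (c * hy + u) + - (c * hx + v) * gy
    regroup = solve-∀

  scale-Nonzero : ∀ {n q} {cs : Vec ℤ n} → q ≢ 0ℤ → Nonzero cs → Nonzero (Vec.map (q *_) cs)
  scale-Nonzero {q = q} q≢0 (here c≢0)   = here λ qc≡0 → [ q≢0 , c≢0 ]′ (i*j≡0⇒i≡0∨j≡0 q qc≡0)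
  scale-Nonzero q≢0 (there cs≢0) = there (scale-Nonzero q≢0 cs≢0)

  -- One equation is traded for one unknown: every combination of `reduced` solves the equation at
  -- `x`, and `lift` rewrites it in the original functions without losing nontriviality.
  record Elimination {A : Set} {n} (x : A) (gs : Vec (A → ℤ) (suc n)) : Set where
    field
      reduced  : Vec (A → ℤ) n
      root     : ∀ cs → comb cs reduced x ≡ 0ℤ
      lift     : Vec ℤ n → Vec ℤ (suc n)
      comb-lift : ∀ cs y → comb (lift cs) gs y ≡ comb cs reduced y
      lift-Nonzero : ∀ {cs} → Nonzero cs → Nonzero (lift cs)

  open Elimination

  eliminate-at : ∀ {A : Set} {n} (x : A) (gs : Vec (A → ℤ) (suc n)) → Elimination x gs
  eliminate-at x (g ∷ gs) with g x ≟ 0ℤ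
  eliminate-at x (g ∷ gs) | no gx≢0 = record
    { reduced  = Vec.map (λ h y → g x * h y + - h x * g y) gs
    ; root     = λ cs → trans (comb-pivot (g x) g x cs gs x) (cancel (g x) _)
    ; lift     = λ cs → - comb cs gs x ∷ Vec.map (g x *_) cs
    ; comb-lift = λ cs y → trans (cong (λ z → - comb cs gs x * g y + z) (comb-scale (g x) cs gs y))
                    (trans (+-comm (- comb cs gs x * g y) _) (sym (comb-pivot (g x) g x cs gs y)))
    ; lift-Nonzero = there ∘ scale-Nonzero gx≢0
    }
    where
    cancel : ∀ q c → q * c + - c * q ≡ 0ℤ
    cancel = solve-∀
  eliminate-at x (g ∷ []) | yes gx≡0 = record
    { reduced  = []
    ; root     = λ { [] → refl }
    -- Here n = 0: no nonzero vector exists to be lifted, so the zero vector will do.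
    ; lift     = λ _ → 0ℤ ∷ []
    ; comb-lift = λ { [] y → refl }
    ; lift-Nonzero = λ ()
    }
  -- `g` already solves the equation and is kept; a pivot is sought further on.
  eliminate-at x (g ∷ gs@(_ ∷ _)) | yes gx≡0 = record
    { reduced  = g ∷ reduced rest
    ; root     = λ { (c ∷ cs) → cong₂ _+_ (trans (cong (c *_) gx≡0) (*-zeroʳ c)) (root rest cs) }
    ; lift     = λ { (c ∷ cs) → c ∷ lift rest cs }
    ; comb-lift = λ { (c ∷ cs) y → cong (λ z → c * g y + z) (comb-lift rest cs y) }
    ; lift-Nonzero = λ { (here c≢0) → here c≢0 ; (there cs≢0) → there (lift-Nonzero rest cs≢0) }
    }
    where
    rest : Elimination x gs
    rest = eliminate-at x gs

  more-unknowns-than-equations : ∀ {A : Set} {n} (gs : Vec (A → ℤ) n) xs → length xs ℕ.< n →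
    ∃ λ cs → Nonzero cs × All (λ x → comb cs gs x ≡ 0ℤ) xs
  more-unknowns-than-equations {n = suc n} gs []       _          = 1ℤ ∷ Vec.replicate n 0ℤ , here (λ ()) , []
  more-unknowns-than-equations {n = suc n} gs (x ∷ xs) (s≤s lt) with eliminate-at x gs
  ... | elim with more-unknowns-than-equations (reduced elim) xs lt
  ...   | cs , cs≢0 , solves = lift elim cs , lift-Nonzero elim cs≢0 ,
    trans (comb-lift elim cs x) (root elim cs) ∷ All.map (λ {y} eq → trans (comb-lift elim cs y) eq) solves

  -- Monomials of given degree and weight

  increment : ∀ {k} → Vec ℕ (suc k) → Vec ℕ (suc k)
  increment (a ∷ α) = suc a ∷ α

  increment-injective : ∀ {k} {α β : Vec ℕ (suc k)} → increment α ≡ increment β → α ≡ β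
  increment-injective {α = a ∷ α} {b ∷ β} refl = refl

  -- A monomial of degree d is a list of d parts, its indices, each at most k. The clauses follow
  -- `p-remove-part`: the top variable divides the monomial or it does not.
  monomials : ∀ k → ℕ → ℕ → List (Vec ℕ (suc k))
  monomials zero    d       zero    = (d ∷ []) ∷ []
  monomials zero    d       (suc w) = []
  monomials (suc k) zero    w       = List.map (0 ∷_) (monomials k zero w)
  monomials (suc k) (suc d) w       =
    delay [] (suc k) (λ v → List.map increment (monomials (suc k) d v)) w ++ List.map (0 ∷_) (monomials k (suc d) w)

  length-monomials : ∀ k d w → length (monomials k d w) ≡ p w d k
  length-monomials zero    d       w       = trans (base w) (sym (p-ℓ-0 d w))
    where
    base : ∀ w → length (monomials zero d w) ≡ p w 0 0
    base zero    = refl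
    base (suc w) = refl
  length-monomials (suc k) zero    w       =
    trans (length-map (0 ∷_) (monomials k 0 w)) (trans (length-monomials k 0 w) (p-0-const k (suc k) w))
  length-monomials (suc k) (suc d) w       = begin
    length (delay [] (suc k) f w ++ List.map (0 ∷_) (monomials k (suc d) w))          ≡⟨ length-++ (delay [] (suc k) f w) ⟩
    length (delay [] (suc k) f w) ℕ.+ length (List.map (0 ∷_) (monomials k (suc d) w))
      ≡⟨ cong₂ ℕ._+_
           (trans (delay-map length [] (suc k) f w) (shift-cong (suc k) (λ v → trans (length-map increment (monomials (suc k) d v)) (length-monomials (suc k) d v)) w))
           (trans (length-map (0 ∷_) (monomials k (suc d) w)) (length-monomials k (suc d) w)) ⟩
    shift (suc k) (λ v → p v d (suc k)) w ℕ.+ p w (suc d) k                           ≡⟨ p-remove-part d k w ⟨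
    p w (suc d) (suc k)                                                               ∎
    where
    open ≡-Reasoning
    f : ℕ → List (Vec ℕ (suc (suc k)))
    f v = List.map increment (monomials (suc k) d v)

  ∈-monomials : ∀ {k} (α : Vec ℕ (suc k)) → α ∈ monomials k (sum α) (weight α)
  ∈-monomials (a ∷ []) rewrite ℕ.*-zeroʳ a | ℕ.+-identityʳ a = here refl
  ∈-monomials {suc k} (zero ∷ β) with sum β | ∈-monomials β
  ... | zero  | β∈ = ∈-map⁺ (0 ∷_) β∈
  ... | suc d | β∈ = ∈-++⁺ʳ (delay [] (suc k) _ (weight β)) (∈-map⁺ (0 ∷_) β∈)
  ∈-monomials {suc k} (suc a ∷ β) = ∈-++⁺ˡ (subst ((suc a ∷ β) ∈_) (sym (trans
    (cong (delay [] (suc k) _) (ℕ.+-assoc (suc k) (a ℕ.* suc k) (weight β)))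
    (delay-≥ [] (suc k) _ (a ℕ.* suc k ℕ.+ weight β)))) (∈-map⁺ increment (∈-monomials (a ∷ β))))

  monomials-sound : ∀ k d w → All (λ α → sum α ≡ d × weight α ≡ w) (monomials k d w)
  monomials-sound zero    d       zero    = (ℕ.+-identityʳ d , trans (ℕ.+-identityʳ _) (ℕ.*-zeroʳ d)) ∷ []
  monomials-sound zero    d       (suc w) = []
  monomials-sound (suc k) zero    w       = All.map⁺ (monomials-sound k zero w)
  monomials-sound (suc k) (suc d) w       = All.++⁺
    (delay-elim (All _) [] (suc k) _ w λ v eq → All.map⁺ (All.map (λ {α} → incremented eq {α}) (monomials-sound (suc k) d v)))
    (All.map⁺ (monomials-sound k (suc d) w))
    where
    incremented : ∀ {v} → suc k ℕ.+ v ≡ w → ∀ {α : Vec ℕ (suc (suc k))} →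
      sum α ≡ d × weight α ≡ v → sum (increment α) ≡ suc d × weight (increment α) ≡ w
    incremented eq {a ∷ α} (refl , refl) = refl , trans (ℕ.+-assoc (suc k) (a ℕ.* suc k) _) eq

  monomials-Unique : ∀ k d w → Unique (monomials k d w)
  monomials-Unique zero    d       zero    = [] ∷ []
  monomials-Unique zero    d       (suc w) = []
  monomials-Unique (suc k) zero    w       = Unique.map⁺ ∷-injectiveʳ (monomials-Unique k zero w)
  monomials-Unique (suc k) (suc d) w       = Unique.++⁺
    (delay-elim Unique [] (suc k) _ w λ v _ → Unique.map⁺ increment-injective (monomials-Unique (suc k) d v))
    (Unique.map⁺ ∷-injectiveʳ (monomials-Unique k (suc d) w))
    λ (α∈₁ , α∈₂) → delay-elim (λ αs → _ ∈ αs → ⊥) (λ ()) (suc k) _ w (λ v _ → heads-differ (monomials (suc k) d v) α∈₂) α∈₁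
    where
    heads-differ : ∀ {α} αs → α ∈ List.map (0 ∷_) (monomials k (suc d) w) → α ∈ List.map increment αs → ⊥
    heads-differ αs α∈₂ α∈₁ with ∈-map⁻ increment α∈₁ | ∈-map⁻ (0 ∷_) α∈₂
    ... | (a ∷ _) , _ , refl | _ , _ , ()

  δ : ∀ {k} → Vec ℕ k → Series k
  δ α β with ≡-dec ℕ._≟_ α β
  ... | yes _ = 1ℤ
  ... | no  _ = 0ℤ

  δ-≡ : ∀ {k} (α : Vec ℕ k) → δ α α ≡ 1ℤ
  δ-≡ α with ≡-dec ℕ._≟_ α α
  ... | yes _   = refl
  ... | no  α≢α = contradiction refl α≢α

  δ-≢ : ∀ {k} {α β : Vec ℕ k} → α ≢ β → δ α β ≡ 0ℤ
  δ-≢ {α = α} {β} α≢β with ≡-dec ℕ._≟_ α β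
  ... | yes α≡β = contradiction α≡β α≢β
  ... | no  _   = refl

  polynomial : ∀ {k} (αs : List (Vec ℕ k)) → Vec ℤ (length αs) → Series k
  polynomial αs cs = comb cs (Vec.map δ (fromList αs))

  polynomial-∉ : ∀ {k β} (αs : List (Vec ℕ k)) cs → All (β ≢_) αs → polynomial αs cs β ≡ 0ℤ
  polynomial-∉ []       []       []           = refl
  polynomial-∉ (α ∷ αs) (c ∷ cs) (β≢α ∷ β∉αs) =
    cong₂ _+_ (trans (cong (c *_) (δ-≢ (β≢α ∘ sym))) (*-zeroʳ c)) (polynomial-∉ αs cs β∉αs)

  polynomial-Nonzero : ∀ {k} (αs : List (Vec ℕ k)) cs → Unique αs → Nonzero cs →
    ∃ λ α → α ∈ αs × polynomial αs cs α ≢ 0ℤ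
  polynomial-Nonzero (α ∷ αs) (c ∷ cs) (α∉αs ∷ _) (here c≢0) = α , here refl , λ eq → c≢0 (trans (sym (begin
    c * δ α α + polynomial αs cs α  ≡⟨ cong₂ (λ x y → c * x + y) (δ-≡ α) (polynomial-∉ αs cs α∉αs) ⟩
    c * 1ℤ + 0ℤ                     ≡⟨ trans (+-identityʳ _) (*-identityʳ c) ⟩
    c                               ∎)) eq)
    where open ≡-Reasoning
  polynomial-Nonzero (α ∷ αs) (c ∷ cs) (α∉αs ∷ unique) (there cs≢0) with polynomial-Nonzero αs cs unique cs≢0
  ... | β , β∈ , ≢0 = β , there β∈ , λ eq → ≢0 (trans (sym (begin
    c * δ α β + polynomial αs cs β  ≡⟨ cong (λ x → c * x + polynomial αs cs β) (δ-≢ (All.lookup α∉αs β∈)) ⟩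
    c * 0ℤ + polynomial αs cs β     ≡⟨ trans (cong (_+ polynomial αs cs β) (*-zeroʳ c)) (+-identityˡ _) ⟩
    polynomial αs cs β              ∎)) eq)
    where open ≡-Reasoning

  polynomial-Supported : ∀ {k} d w cs → Supported (polynomial (monomials k d w) cs) d w
  polynomial-Supported {k} d w cs α α∉ = polynomial-∉ (monomials k d w) cs
    (All.map (λ { (s , v) refl → α∉ (s , v) }) (monomials-sound k d w))

  -- Reduces an identity between homogeneous series to finitely many equations, the form in which
  -- linear algebra delivers it.
  Supported-vanish : ∀ {k d w} {f : Series (suc k)} → Supported f d w →
    All (λ α → f α ≡ 0ℤ) (monomials k d w) → ∀ α → f α ≡ 0ℤ
  Supported-vanish {d = d} {w} supp f≡0 α with sum α ℕ.≟ d ×-dec weight α ℕ.≟ w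
  ... | yes (refl , refl) = All.lookup f≡0 (∈-monomials α)
  ... | no  α∉            = supp α α∉

  -- Seminvariants and strict growth

  record Seminvariant (m d w : ℕ) : Set where
    field
      series    : Series (suc m)
      supported : Supported series d w
      invariant : ∀ α → E series α ≡ 0ℤ
      nonzero   : ∃ λ α → series α ≢ 0ℤ

  open Seminvariant

  -- A power of x_0, used to raise the degree of a product without changing its weight.
  Seminvariant-0 : ∀ {m d} → Seminvariant m d 0
  Seminvariant-0 {m} {d} = record
    { series    = δ α₀
    ; supported = supp
    ; invariant = E-Supported-0 supp
    ; nonzero   = α₀ , λ eq → case trans (sym (δ-≡ α₀)) eq of λ ()
    }
    where
    x₀^_ : ∀ {m} d → Vec ℕ (suc m)
    x₀^_ {zero}  d = d ∷ []
    x₀^_ {suc m} d = 0 ∷ x₀^ d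
    sum-x₀^ : ∀ m d → sum (x₀^_ {m} d) ≡ d
    sum-x₀^ zero    d = ℕ.+-identityʳ d
    sum-x₀^ (suc m) d = sum-x₀^ m d
    weight-x₀^ : ∀ m d → weight (x₀^_ {m} d) ≡ 0
    weight-x₀^ zero    d = trans (ℕ.+-identityʳ _) (ℕ.*-zeroʳ d)
    weight-x₀^ (suc m) d = weight-x₀^ m d
    α₀ : Vec ℕ (suc m)
    α₀ = x₀^ d
    supp : Supported (δ α₀) d 0
    supp α α∉ = δ-≢ {α = α₀} λ { refl → α∉ (sum-x₀^ m d , weight-x₀^ m d) }

  Seminvariant-+ : ∀ {m d d′ w w′} → Seminvariant m d w → Seminvariant m d′ w′ → Seminvariant m (d ℕ.+ d′) (w ℕ.+ w′)
  Seminvariant-+ {m} {d} {d′} {w} {w′} s t = record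
    { series    = f ⊛ g
    ; supported = fg-supp
    ; invariant = λ α → trans (E-⊛ f g α)
        (cong₂ _+_ (vanish (⊛-linearˡ g) (invariant s) α) (vanish (⊛-linearʳ f) (invariant t) α))
    ; nonzero   = find-nonzero
    }
    where
    f g : Series (suc m)
    f = series s
    g = series t
    fg-supp : Supported (f ⊛ g) (d ℕ.+ d′) (w ℕ.+ w′)
    fg-supp = ⊛-Supported (supported s) (supported t)
    find-nonzero : ∃ λ α → (f ⊛ g) α ≢ 0ℤ
    -- Cancellation only refutes that the product is 0. Homogeneity leaves finitely many monomials,
    -- so a nonzero coefficient can be found by search.
    find-nonzero with All.all? (λ α → (f ⊛ g) α ≟ 0ℤ) (monomials m (d ℕ.+ d′) (w ℕ.+ w′))
    ... | yes fg≡0 = contradiction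
      (⊛-cancelʳ f g (Supported-vanish fg-supp fg≡0) (nonzero t) (proj₁ (nonzero s))) (proj₂ (nonzero s))
    ... | no ¬fg≡0 = map₂ proj₂ (find (All.¬All⇒Any¬ (λ α → (f ⊛ g) α ≟ 0ℤ) _ ¬fg≡0))

  p-<⇒Seminvariant : ∀ m d w → p w d m ℕ.< p (suc w) d m → Seminvariant m d (suc w)
  p-<⇒Seminvariant m d w lt
    with more-unknowns-than-equations (Vec.map E (Vec.map δ (fromList (monomials m d (suc w))))) (monomials m d w)
           (subst₂ ℕ._<_ (sym (length-monomials m d w)) (sym (length-monomials m d (suc w))) lt)
  ... | cs , cs≢0 , solves = record
    { series    = f
    ; supported = polynomial-Supported d (suc w) cs
    ; invariant = Supported-vanish (E-Supported (polynomial-Supported d (suc w) cs))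
        (All.map (λ {α} eq → trans (Linear-comb E-linear cs _ α) eq) solves)
    ; nonzero   = map₂ proj₂ (polynomial-Nonzero (monomials m d (suc w)) cs (monomials-Unique m d (suc w)) cs≢0)
    }
    where
    f : Series (suc m)
    f = polynomial (monomials m d (suc w)) cs

  -- Otherwise f and the images under F of the monomials of weight w outnumber the monomials of
  -- weight w + 1, so c f + F g = 0 with coefficients not all 0. Applying E removes f; injectivity
  -- of E F gives g = 0, and then c f = 0 forces c = 0.
  Seminvariant⇒p-< : ∀ m d w h → m ℕ.* d ≡ 2 ℕ.* w ℕ.+ suc h → Seminvariant m d (suc w) → p w d m ℕ.< p (suc w) d m
  Seminvariant⇒p-< m d w h eq s with p w d m ℕ.<? p (suc w) d m
  ... | yes lt = lt
  ... | no ≮ with more-unknowns-than-equations (series s ∷ Vec.map (F 1) (Vec.map δ (fromList (monomials m d w)))) (monomials m d (suc w))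
           (s≤s (subst₂ ℕ._≤_ (sym (length-monomials m d (suc w))) (sym (length-monomials m d w)) (ℕ.≮⇒≥ ≮)))
  ...   | c ∷ cs , cs≢0 , solves = contradiction cs≢0 all-zero
    where
    f g : Series (suc m)
    f = series s
    g = polynomial (monomials m d w) cs
    cf+Fg≡0 : ∀ α → c * f α + F 1 g α ≡ 0ℤ
    cf+Fg≡0 = Supported-vanish {d = d} {suc w}
      (λ α α∉ → cong₂ _+_ (trans (cong (c *_) (supported s α α∉)) (*-zeroʳ c)) (F-Supported 1 (polynomial-Supported d w cs) α α∉))
      (All.map (λ {α} eq → trans (cong (λ z → c * f α + z) (Linear-comb (F-linear 1) cs _ α)) eq) solves)
    EFg≡0 : ∀ α → E (F 1 g) α + 0ℤ * g α ≡ 0ℤ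
    EFg≡0 α = begin
      E (F 1 g) α + 0ℤ * g α               ≡⟨ +-identityʳ _ ⟩
      E (F 1 g) α                          ≡⟨ +-identityˡ _ ⟨
      0ℤ + E (F 1 g) α                     ≡⟨ cong (_+ E (F 1 g) α) (trans (cong (c *_) (invariant s α)) (*-zeroʳ c)) ⟨
      c * E f α + E (F 1 g) α              ≡⟨ cong (_+ E (F 1 g) α) (E-linear .*-homo c f α) ⟨
      E (λ β → c * f β) α + E (F 1 g) α    ≡⟨ E-linear .+-homo _ _ α ⟨
      E (λ β → c * f β + F 1 g β) α        ≡⟨ vanish E-linear cf+Fg≡0 α ⟩
      0ℤ                                   ∎
      where open ≡-Reasoning
    g≡0 : ∀ α → g α ≡ 0ℤ
    -- Injectivity of E F is the case c = 0, which explains the summand `0ℤ * g α` in `EFg≡0`.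
    g≡0 = EF-negative⇒0 w 0 g (polynomial-Supported d w cs) eq EFg≡0
    all-zero : ¬ Nonzero (c ∷ cs)
    cf≡0 : ∀ α → c * f α ≡ 0ℤ
    cf≡0 α = begin
      c * f α            ≡⟨ +-identityʳ _ ⟨
      c * f α + 0ℤ       ≡⟨ cong (λ z → c * f α + z) (vanish (F-linear 1) g≡0 α) ⟨
      c * f α + F 1 g α  ≡⟨ cf+Fg≡0 α ⟩
      0ℤ                 ∎
      where open ≡-Reasoning
    all-zero (there cs≢0) =
      let α , _ , gα≢0 = polynomial-Nonzero (monomials m d w) cs (monomials-Unique m d w) cs≢0 in gα≢0 (g≡0 α)
    all-zero (here c≢0) =
      let α , fα≢0 = nonzero s in [ c≢0 , fα≢0 ]′ (i*j≡0⇒i≡0∨j≡0 c (cf≡0 α))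

open import Data.Nat
open import Data.Nat.Properties
open import Data.Nat.Tactic.RingSolver using (solve-∀)
open Partitions
open Seminvariants

-- Enlarging the rectangle by eight

⌊m+m/2⌋ : ∀ m n → ⌊ m + m + n /2⌋ ≡ m + ⌊ n /2⌋
⌊m+m/2⌋ zero    n = refl
⌊m+m/2⌋ (suc m) n = trans (cong (λ k → ⌊ suc k + n /2⌋) (+-suc m m)) (cong suc (⌊m+m/2⌋ m n))

≤⌊/2⌋ : ∀ w n → w ≤ ⌊ n /2⌋ → 2 * w ≤ n
≤⌊/2⌋ w n le = begin
  2 * w                  ≤⟨ *-monoʳ-≤ 2 le ⟩
  2 * ⌊ n /2⌋            ≡⟨ cong (⌊ n /2⌋ +_) (+-identityʳ _) ⟩
  ⌊ n /2⌋ + ⌊ n /2⌋      ≤⟨ +-monoʳ-≤ ⌊ n /2⌋ (⌊n/2⌋≤⌈n/2⌉ n) ⟩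
  ⌊ n /2⌋ + ⌈ n /2⌉      ≡⟨ ⌊n/2⌋+⌈n/2⌉≡n n ⟩
  n                      ∎
  where open ≤-Reasoning

-- The weights start at 2 because the strict chain starts with the step from 1 to 2.
strict⇒Seminvariant : ∀ {ℓ m} → StrictlyIncreasing ℓ m → ∀ w → 2 ≤ w → w ≤ ⌊ ℓ * m /2⌋ → Seminvariant m ℓ w
strict⇒Seminvariant {ℓ} {m} strict (suc w) (s≤s 1≤w) w< = p-<⇒Seminvariant m ℓ w (strict w 1≤w w<)

Seminvariants⇒strict : ∀ {ℓ m} → (∀ w → 2 ≤ w → w ≤ ⌊ ℓ * m /2⌋ → Seminvariant m ℓ w) → StrictlyIncreasing ℓ m
Seminvariants⇒strict {ℓ} {m} seminvariant w 1≤w w< =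
  Seminvariant⇒p-< m ℓ w (suc excess) decompose (seminvariant (suc w) (s≤s 1≤w) w<)
  where
  open ≡-Reasoning
  excess : ℕ
  excess = ℓ * m ∸ 2 * suc w
  index : ∀ w e → 2 * (1 + w) + e ≡ 2 * w + (1 + (1 + e))
  index = solve-∀
  -- From 2(w + 1) ≤ ℓm, the value of m deg - 2 weight in weight w is at least 2, hence positive.
  decompose : m * ℓ ≡ 2 * w + suc (suc excess)
  decompose = begin
    m * ℓ                       ≡⟨ *-comm m ℓ ⟩
    ℓ * m                       ≡⟨ m+[n∸m]≡n (≤⌊/2⌋ (suc w) (ℓ * m) w<) ⟨
    2 * suc w + excess          ≡⟨ index w excess ⟩
    2 * w + suc (suc excess)    ∎

-- The weights {0} ∪ [2, A] and {0} ∪ [2, B] add up to {0} ∪ [2, A + B]; here A = 4 m is exactly half of 8 m.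
strict-8+ : ∀ {ℓ m} → 1 ≤ m → StrictlyIncreasing 8 m → StrictlyIncreasing ℓ m → 2 ≤ ⌊ ℓ * m /2⌋ → StrictlyIncreasing (8 + ℓ) m
strict-8+ {ℓ} {m} 1≤m strict₈ strictₗ 2≤B = Seminvariants⇒strict seminvariant
  where
  A : ℕ
  A = 4 * m
  ⌊8m/2⌋ : ⌊ 8 * m /2⌋ ≡ A
  ⌊8m/2⌋ = trans (cong ⌊_/2⌋ (double m)) (trans (⌊m+m/2⌋ A 0) (+-identityʳ A))
    where
    double : ∀ m → 8 * m ≡ 4 * m + 4 * m + 0
    double = solve-∀
  ⌊[8+ℓ]m/2⌋ : ⌊ (8 + ℓ) * m /2⌋ ≡ A + ⌊ ℓ * m /2⌋
  ⌊[8+ℓ]m/2⌋ = trans (cong ⌊_/2⌋ (double ℓ m)) (⌊m+m/2⌋ A (ℓ * m))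
    where
    double : ∀ ℓ m → (8 + ℓ) * m ≡ 4 * m + 4 * m + ℓ * m
    double = solve-∀
  4≤A : 4 ≤ A
  4≤A = *-monoʳ-≤ 4 1≤m
  first : ∀ w → 2 ≤ w → w ≤ A → Seminvariant m 8 w
  first w 2≤w w≤A = strict⇒Seminvariant strict₈ w 2≤w (subst (w ≤_) (sym ⌊8m/2⌋) w≤A)
  seminvariant : ∀ w → 2 ≤ w → w ≤ ⌊ (8 + ℓ) * m /2⌋ → Seminvariant m (8 + ℓ) w
  seminvariant w 2≤w w≤ with w ≤? A
  ... | yes w≤A = subst (Seminvariant m (8 + ℓ)) (+-identityʳ w) (Seminvariant-+ (first w 2≤w w≤A) Seminvariant-0)
  ... | no  w≰A with m≤n⇒∃[o]m+o≡n (≰⇒> w≰A)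
  -- Weight A + 1 cannot be split as A + 1 for want of weight 1, so it is split as (A - 1) + 2; A ≥
  -- 4 keeps A - 1 in range.
  ...   | zero , refl = subst (Seminvariant m (8 + ℓ)) index
    (Seminvariant-+ (first (pred A) (pred-mono-≤ (≤-trans (m≤m+n 3 1) 4≤A)) pred[n]≤n) (strict⇒Seminvariant strictₗ 2 ≤-refl 2≤B))
    where
    index : pred A + 2 ≡ suc (A + 0)
    index = trans (+-suc (pred A) 1) (cong suc (trans (+-comm (pred A) 1) (trans (suc-pred A {{>-nonZero (≤-trans (s≤s z≤n) 4≤A)}}) (sym (+-identityʳ A)))))
  ...   | suc v , refl = subst (Seminvariant m (8 + ℓ)) (+-suc A (suc v))
    (Seminvariant-+ (first A (≤-trans (m≤m+n 2 2) 4≤A) ≤-refl)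
      (strict⇒Seminvariant strictₗ (2 + v) (m≤m+n 2 v)
        (+-cancelˡ-≤ A _ _ (subst₂ _≤_ (sym (+-suc A (suc v))) ⌊[8+ℓ]m/2⌋ w≤))))

strict-transpose : ∀ ℓ m → StrictlyIncreasing ℓ m → StrictlyIncreasing m ℓ
strict-transpose ℓ m strict n 1≤n n< =
  subst₂ _<_ (p-transpose ℓ m n) (p-transpose ℓ m (suc n)) (strict n 1≤n (subst (λ k → n < ⌊ k /2⌋) (*-comm m ℓ) n<))

by-eights : (P : ℕ → Set) → (∀ i → i < 8 → P (8 + i)) → (∀ n → 8 ≤ n → P n → P (8 + n)) → ∀ n → 8 ≤ n → P n
by-eights P base step n 8≤n = subst P (m+[n∸m]≡n 8≤n) (from-8 (n ∸ 8))
  where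
  from-8 : ∀ n → P (8 + n)
  from-8 0 = base 0 (m≤m+n 1 7)
  from-8 1 = base 1 (m≤m+n 2 6)
  from-8 2 = base 2 (m≤m+n 3 5)
  from-8 3 = base 3 (m≤m+n 4 4)
  from-8 4 = base 4 (m≤m+n 5 3)
  from-8 5 = base 5 (m≤m+n 6 2)
  from-8 6 = base 6 (m≤m+n 7 1)
  from-8 7 = base 7 (m≤m+n 8 0)
  from-8 (suc (suc (suc (suc (suc (suc (suc (suc n)))))))) = step (8 + n) (m≤m+n 8 n) (from-8 n)

strict-from-column : ∀ {m} → 8 ≤ m → (∀ i → i < 8 → StrictlyIncreasing (8 + i) m) → ∀ ℓ → 8 ≤ ℓ → StrictlyIncreasing ℓ m
strict-from-column {m} 8≤m base = by-eights (λ ℓ → StrictlyIncreasing ℓ m) base λ ℓ 8≤ℓ strict →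
  -- `base 0` is the rectangle 8 × m, the source of the factors of degree 8. Below, 2 + 30 = 32 is
  -- half of 8 · 8.
  strict-8+ {ℓ} (≤-trans (s≤s z≤n) 8≤m) (base 0 (s≤s z≤n)) strict
    (≤-trans (m≤m+n 2 30) (⌊n/2⌋-mono (*-mono-≤ 8≤ℓ 8≤m)))

-- Two sweeps. With one side fixed at 8 + i, the other grows from the computed range to `m`;
-- transposed, these are the eight starting cases from which `ℓ` grows with `m` fixed.
strictly-increasing : ∀ ℓ m → 8 ≤ ℓ → 8 ≤ m → StrictlyIncreasing ℓ m
strictly-increasing ℓ m 8≤ℓ 8≤m = strict-from-column 8≤m
  (λ i i<8 → strict-transpose m (8 + i) (strict-from-column (m≤m+n 8 i) (λ j j<8 → base-case j i j<8 i<8) m 8≤m)) ℓ 8≤ℓ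

theorem1 : (ℓ m : ℕ) → 8 ≤ ℓ → 8 ≤ m →
    ((n : ℕ) → 1 ≤ n → n < ⌊ ℓ * m /2⌋ → p n ℓ m < p (suc n) ℓ m)
    × (p ⌊ ℓ * m /2⌋ ℓ m ≡ p ⌈ ℓ * m /2⌉ ℓ m)
    × ((n : ℕ) → ⌈ ℓ * m /2⌉ ≤ n → suc n < ℓ * m → p n ℓ m > p (suc n) ℓ m)
theorem1 ℓ m 8≤ℓ 8≤m = increasing′ , p-complement ℓ m _ _ (⌊n/2⌋+⌈n/2⌉≡n N) , decreasing
  where
  N : ℕ
  N = ℓ * m
  increasing′ : StrictlyIncreasing ℓ m
  increasing′ = strictly-increasing ℓ m 8≤ℓ 8≤m
  decreasing : ∀ n → ⌈ N /2⌉ ≤ n → suc n < N → p n ℓ m > p (suc n) ℓ m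
  decreasing n ⌈N/2⌉≤n 1+n<N with m≤n⇒∃[o]m+o≡n 1+n<N
  -- With n + 2 + r = ℓm, complementation sends n + 1 and n to r + 1 and r + 2. The index r + 1 is
  -- at least 1, and n ≥ ⌈ℓm/2⌉ puts r + 2 in the lower half.
  ... | r , eq = subst₂ _<_
    (p-complement ℓ m (suc r) (suc n) (trans (cong suc (+-comm r (suc n))) eq))
    (p-complement ℓ m (2 + r) n (trans (cong (2 +_) (+-comm r n)) eq))
    (increasing′ (suc r) (s≤s z≤n) (+-cancelʳ-≤ n _ _ (begin
      2 + r + n                ≡⟨ cong (2 +_) (+-comm r n) ⟩
      2 + n + r                ≡⟨ eq ⟩
      N                        ≡⟨ ⌊n/2⌋+⌈n/2⌉≡n N ⟨
      ⌊ N /2⌋ + ⌈ N /2⌉        ≤⟨ +-monoʳ-≤ ⌊ N /2⌋ ⌈N/2⌉≤n ⟩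
      ⌊ N /2⌋ + n              ∎)))
    where open ≤-Reasoning
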